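{- For every $n\ge 2$, both the weak rectangulotope $\mathbb{WR}(n)$ and the strong rectangulotope $\mathbb{SR}(n)$ have exactly $2^n-2$ facets, one for each subset $\varnothing\ne X\subsetneq[n]$ (the facet corresponding to $X$ having outer normal vector $\sum_{i\in X}\boldsymbol{e}_i$, modulo $(1,\dots,1)$).
   Context: Notation: $[n]=\{1,\dots,n\}$, $\boldsymbol{e}_1,\dots,\boldsymbol{e}_n$ is the standard basis of $\mathbb{R}^n$. Rectangulations. A rectangulation of size $n$ is a decomposition of an axis-parallel square into $n$ axis-parallel rectangles with disjoint interiors; all rectangulations are assumed generic, i.e. no four rectangles have a common vertex. The segments of a rectangulation are the inclusionwise maximal line segments composed of edges of the rectangles, excluding the edges of the square. A rectangle $r$ is above a rectangle $s$ (and $s$ is below $r$) if there is a sequence $r=r_0,\dots,r_k=s$ ($k\ge1$) of rectangles such that the bottom edge of $r_{i-1}$ lies in the same segment as the top edge of $r_i$ for all $i\in[k]$; "on the left of" and "on the right of" are defined similarly. Two rectangulations are weakly equivalent if there is a bijection between their rectangles preserving both the relation "$r$ is above $s$" and the relation "$r$ is on the left of $s$", and strongly equivalent if the bijection moreover preserves the adjacency relation; weak (resp. strong) rectangulations are the weak (resp. strong) equivalence classes. The rectangles of $R$ are labeled by $[n]$ by the total order in which $i<j$ when $r_j$ is below or on the right of $r_i$ (where $r_i$ is the rectangle labeled $i$). Weak poset. For a rectangle $r$, let $s(r)$ be its bottom--left corner and $t(r)$ its top--right corner. Consider the directed graph on all vertices of $R$ with, for each rectangle, the four edges joining its consecutive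 corners, horizontal ones oriented left to right, vertical ones bottom to top. The source tree $S(R)$ (resp. target tree $T(R)$) is the subgraph induced by the points $s(r_i)$ (resp. $t(r_i)$), with $s(r_i)$ (resp. $t(r_i)$) labeled $i$. The weak poset $\prec_w^R$ on $[n]$ is the transitive closure of the union of the edge relations of $S(R)$ and $T(R)$ (an edge $i\to j$ gives $i\prec_w^R j$). Strong poset. The adjacency poset $\lhd$ of $R$ is the transitive closure of the directed graph on $[n]$ obtained from the adjacency graph of the rectangles by orienting edges from left to right and from bottom to top. The special relation has $i\blacktriangleleft j$ if either the right side of $r_j$ and the left side of $r_i$ lie on the same vertical segment and the bottom--right corner of $r_j$ is above the top--left corner of $r_i$, or the top side of $r_j$ and the bottom side of $r_i$ lie on the same horizontal segment and the top--left corner of $r_j$ lies on the right of the bottom--right corner of $r_i$. The strong poset $\prec_s^R$ is the transitive closure of the union of $\lhd$ and $\blacktriangleleft$. Rectangulotopes. $\mathbb{WR}(n)$ (resp. $\mathbb{SR}(n)$) is a polytope in $\mathbb{R}^n$ whose normal fan is the complete fan with maximal cones $\{x\in\mathbb{R}^n: x_i\le x_j\text{ whenever } i\prec_w^R j\}$ for all weak rectangulations $R$ of size $n$ (resp. $\{x\in\mathbb{R}^n: x_i\le x_j\text{ whenever } i\prec_s^R j\}$ for all strong rectangulations $R$ of size $n$). The normal cone of a face $F$ of a polytope $P$ is the set of $v$ such that $x\mapsto\langle v,x\rangle$ is maximized over $P$ at every point of $F$. Such polytopes have dimension $n-1$ and lie in a hyperplane orthogonal to $(1,\dots,1)$. 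-}

module Defs where

open import Algebra.Bundles using (CommutativeRing)
import Algebra.Properties.Semiring.Sum as Sum
open import Data.Bool.Base using (if_then_else_)
open import Data.Fin.Base as Fin using (Fin)
import Data.Fin.Properties as Fin
open import Data.Fin.Subset using (Subset; Nonempty; ⊤; _⊂_)
open import Data.Nat.Base as ℕ using (ℕ; suc)
open import Data.Product.Base using (Σ; Σ-syntax; ∃; ∃-syntax; _×_; proj₁)
open import Data.Sum.Base using (_⊎_)
import Data.Vec.Base as Vec
open import Data.Vec.Functional using (Vector)
open import Function.Base using (flip)
open import Function.Bundles using (Bijection; _⇔_)
open import Function.Definitions using (Injective)
open import Level using (0ℓ) renaming (suc to lsuc)
open import Relation.Binary.Bundles using (Setoid)
import Relation.Binary.Construct.Closure.Transitive as Plus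
import Relation.Binary.Construct.NonStrictToStrict as ToStrict
import Relation.Binary.Construct.On as On
open import Relation.Binary.Core using (Rel)
open import Relation.Binary.PropositionalEquality.Core using (_≡_; _≢_)
import Relation.Binary.PropositionalEquality.Properties as ≡
open import Relation.Binary.Structures using (IsDecTotalOrder)
open import Relation.Nullary.Negation.Core using (¬_)
open import Relation.Unary using (Pred; _∈_; _⊆_; _≐_)
open import Relation.Unary.Relation.Binary.Equality using (≐-setoid)

-- The real numbers, characterised classically as a Dedekind-complete
-- totally ordered field.  Equality is a setoid equality, so that the Cauchy
-- reals are, under excluded middle, a model.

record RealNumbers : Set₁ where
  infix 4 _≤_
  field
    commutativeRing : CommutativeRing 0ℓ 0ℓ
  open CommutativeRing commutativeRing public
  field
    _≤_             : Rel Carrier 0ℓ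
    isDecTotalOrder : IsDecTotalOrder _≈_ _≤_
    0≉1             : ¬ (0# ≈ 1#)
    inverse         : ∀ x → ¬ (x ≈ 0#) → ∃[ y ] x * y ≈ 1#
    +-monoʳ-≤       : ∀ x {y z} → y ≤ z → x + y ≤ x + z
    *-nonNegative   : ∀ {x y} → 0# ≤ x → 0# ≤ y → 0# ≤ x * y

  open ToStrict _≈_ _≤_ public using (_<_)

  UpperBound : Pred Carrier 0ℓ → Pred Carrier 0ℓ
  UpperBound S u = ∀ x → x ∈ S → x ≤ u

  field
    supremum : ∀ (S : Pred Carrier 0ℓ) → ∃ S → ∃ (UpperBound S) →
               ∃[ s ] (UpperBound S s × (∀ u → UpperBound S u → s ≤ u))

module _ (ℝ : RealNumbers) where

  open RealNumbers ℝ
  open Sum semiring using (sum)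

  data Axis : Set where
    x-axis y-axis : Axis

  other : Axis → Axis
  other x-axis = y-axis
  other y-axis = x-axis

  Point : Set
  Point = Axis → Carrier

  _≈ₚ_ : Rel Point 0ℓ
  p ≈ₚ q = ∀ a → p a ≈ q a

  -- The product of the intervals [ lo a , hi a ].  Thus lo is the
  -- bottom-left corner s(r) and hi is the top-right corner t(r).

  record Rectangle : Set where
    field
      lo hi : Point
      lo<hi : ∀ a → lo a < hi a

  open Rectangle

  topLeft bottomRight : Rectangle → Point
  topLeft r x-axis = lo r x-axis
  topLeft r y-axis = hi r y-axis
  bottomRight r x-axis = hi r x-axis
  bottomRight r y-axis = lo r y-axis

  Inside StrictlyInside IsCorner : Rectangle → Pred Point 0ℓ
  Inside         r p = ∀ a → lo r a ≤ p a × p a ≤ hi r a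
  StrictlyInside r p = ∀ a → lo r a < p a × p a < hi r a
  IsCorner       r p = ∀ a → p a ≈ lo r a ⊎ p a ≈ hi r a

  record Decomposition (n : ℕ) : Set where
    field
      square   : Rectangle
      isSquare : hi square x-axis - lo square x-axis ≈
                 hi square y-axis - lo square y-axis
      rect     : Fin n → Rectangle
      inside   : ∀ i → Inside (rect i) ⊆ Inside square
      covering : ∀ p → p ∈ Inside square → ∃[ i ] p ∈ Inside (rect i)
      disjoint : ∀ {i j} → i ≢ j → ∀ p →
                 ¬ (p ∈ StrictlyInside (rect i) × p ∈ StrictlyInside (rect j))
      generic  : ∀ p (f : Fin 4 → Fin n) → Injective _≡_ _≡_ f →
                 ¬ (∀ k → p ∈ IsCorner (rect (f k)))

  module _ {n : ℕ} (D : Decomposition n) where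

    open Decomposition D

    private
      l h : Fin n → Point
      l i = lo (rect i)
      h i = hi (rect i)

    -- The points whose a-coordinate is c and whose other coordinate lies in
    -- [ p , q ] form a nondegenerate line segment, not on the boundary of
    -- the square, that is a union of edges of rectangles.

    record ComposedOfEdges (a : Axis) (c p q : Carrier) : Set where
      field
        p<q      : p < q
        interior : lo square a < c × c < hi square a
        edges    : ∀ t → p ≤ t → t ≤ q →
                   ∃[ i ] ( (c ≈ l i a ⊎ c ≈ h i a)
                          × (l i (other a) ≤ t × t ≤ h i (other a))
                          × (p ≤ l i (other a) × h i (other a) ≤ q))

    IsSegment : (a : Axis) (c p q : Carrier) → Set
    IsSegment a c p q =
      ComposedOfEdges a c p q ×
      (∀ p′ q′ → ComposedOfEdges a c p′ q′ → p′ ≤ p → q ≤ q′ → p′ ≈ p × q′ ≈ q)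

    -- The high side of rᵢ and the low side of rⱼ in direction a lie on the
    -- same segment: right side and left side for the x-axis, top side and
    -- bottom side for the y-axis.

    CommonSegment : Axis → Rel (Fin n) 0ℓ
    CommonSegment a i j =
      ∃[ c ] ∃[ p ] ∃[ q ]
        ( IsSegment a c p q
        × (h i a ≈ c × p ≤ l i (other a) × h i (other a) ≤ q)
        × (l j a ≈ c × p ≤ l j (other a) × h j (other a) ≤ q))

    Above Below LeftOf RightOf : Rel (Fin n) 0ℓ
    Above   = Plus.TransClosure (flip (CommonSegment y-axis))
    Below   = flip Above
    LeftOf  = Plus.TransClosure (CommonSegment x-axis)
    RightOf = flip LeftOf

    Arc : Rel Point 0ℓ
    Arc p q = ∃[ k ]
      ( (p ≈ₚ lo (rect k)          × q ≈ₚ bottomRight (rect k))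
      ⊎ (p ≈ₚ topLeft (rect k)     × q ≈ₚ hi (rect k))
      ⊎ (p ≈ₚ lo (rect k)          × q ≈ₚ topLeft (rect k))
      ⊎ (p ≈ₚ bottomRight (rect k) × q ≈ₚ hi (rect k)))

    SourceTree TargetTree : Rel (Fin n) 0ℓ
    SourceTree i j = Arc (lo (rect i)) (lo (rect j))
    TargetTree i j = Arc (hi (rect i)) (hi (rect j))

    WeakPoset : Rel (Fin n) 0ℓ
    WeakPoset = Plus.TransClosure (λ i j → SourceTree i j ⊎ TargetTree i j)

    -- rᵢ and rⱼ share a nondegenerate piece of boundary, with rᵢ on the left
    -- of rⱼ (for the x-axis) or below rⱼ (for the y-axis).

    Adjacent : Rel (Fin n) 0ℓ
    Adjacent i j = ∃[ a ]
      ( h i a ≈ l j a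
      × l i (other a) < h j (other a)
      × l j (other a) < h i (other a))

    AdjacencyPoset : Rel (Fin n) 0ℓ
    AdjacencyPoset = Plus.TransClosure Adjacent

    -- For the x-axis, the corner of rⱼ is its bottom-right corner, above the
    -- top-left corner of rᵢ; for the y-axis, the corner of rⱼ is its top-left
    -- corner, on the right of the bottom-right corner of rᵢ.

    Special : Rel (Fin n) 0ℓ
    Special i j = ∃[ a ]
      (CommonSegment a j i × h i (other a) < l j (other a))

    StrongPoset : Rel (Fin n) 0ℓ
    StrongPoset = Plus.TransClosure (λ i j → AdjacencyPoset i j ⊎ Special i j)

  record Rectangulation (n : ℕ) : Set where
    field
      decomposition : Decomposition n
      labelling     : ∀ i j → i Fin.< j ⇔
                      (Below decomposition j i ⊎ RightOf decomposition j i)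

  ⟨_,_⟩ : ∀ {n} → Vector Carrier n → Vector Carrier n → Carrier
  ⟨ v , w ⟩ = sum (λ i → v i * w i)

  -- A nonempty polytope, as the convex hull of finitely many points.

  record Polytope (n : ℕ) : Set where
    field
      {size} : ℕ
      points : Fin (suc size) → Vector Carrier n

  Hull : ∀ {n} → Polytope n → Pred (Vector Carrier n) 0ℓ
  Hull P x = ∃[ t ]
    ( (∀ k → 0# ≤ t k)
    × sum t ≈ 1#
    × (∀ i → x i ≈ sum (λ k → t k * Polytope.points P k i)))

  Maximizers : ∀ {n} → Polytope n → Vector Carrier n → Pred (Vector Carrier n) 0ℓ
  Maximizers P v x = x ∈ Hull P × (∀ y → y ∈ Hull P → ⟨ v , y ⟩ ≤ ⟨ v , x ⟩)

  IsFace : ∀ {n} → Polytope n → Pred (Vector Carrier n) 0ℓ → Set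
  IsFace P F = ∃[ v ] F ≐ Maximizers P v

  AffinelyIndependent : ∀ {n k} → (Fin k → Vector Carrier n) → Set
  AffinelyIndependent p =
    ∀ t → sum t ≈ 0# → (∀ i → sum (λ k → t k * p k i) ≈ 0#) → ∀ k → t k ≈ 0#

  HasDimension : ∀ {n} → Pred (Vector Carrier n) 0ℓ → ℕ → Set
  HasDimension {n} S d =
    (Σ[ p ∈ (Fin (suc d) → Vector Carrier n) ]
       (∀ k → p k ∈ S) × AffinelyIndependent p) ×
    (∀ (p : Fin (suc (suc d)) → Vector Carrier n) →
       (∀ k → p k ∈ S) → ¬ AffinelyIndependent p)

  IsFacet : ∀ {n} → Polytope n → Pred (Vector Carrier n) 0ℓ → Set
  IsFacet P F =
    IsFace P F × ∃[ d ] (HasDimension (Hull P) (suc d) × HasDimension F d)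

  facets : ∀ {n} → Polytope n → Setoid (lsuc 0ℓ) 0ℓ
  facets {n} P = On.setoid {B = ∃ (IsFacet P)} (≐-setoid (Vector Carrier n) 0ℓ) proj₁

  NormalCone : ∀ {n} → Polytope n → Pred (Vector Carrier n) 0ℓ → Pred (Vector Carrier n) 0ℓ
  NormalCone P F v = F ⊆ Maximizers P v

  InNormalFan : ∀ {n} → Polytope n → Pred (Vector Carrier n) 0ℓ → Set₁
  InNormalFan P C = ∃[ F ] (IsFace P F × C ≐ NormalCone P F)

  IsMaximalCone : ∀ {n} → Polytope n → Pred (Vector Carrier n) 0ℓ → Set₁
  IsMaximalCone P C =
    InNormalFan P C × (∀ C′ → InNormalFan P C′ → C ⊆ C′ → C′ ⊆ C)

  OrderCone : ∀ {n} → Rel (Fin n) 0ℓ → Pred (Vector Carrier n) 0ℓ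
  OrderCone _≺_ x = ∀ i j → i ≺ j → x i ≤ x j

  weakCone strongCone : ∀ {n} → Rectangulation n → Pred (Vector Carrier n) 0ℓ
  weakCone   R = OrderCone (WeakPoset (Rectangulation.decomposition R))
  strongCone R = OrderCone (StrongPoset (Rectangulation.decomposition R))

  -- The set of maximal cones of the normal fan is the set of all cone R.  As
  -- equivalent rectangulations have the same cone, R may run over all
  -- rectangulations instead of over their equivalence classes.

  MaximalConesAre : ∀ {n} → Polytope n →
                    (Rectangulation n → Pred (Vector Carrier n) 0ℓ) → Set₁
  MaximalConesAre P cone =
    (∀ R → IsMaximalCone P (cone R)) ×
    (∀ C → IsMaximalCone P C → ∃[ R ] C ≐ cone R)

  IsWeakRectangulotope IsStrongRectangulotope : ∀ {n} → Polytope n → Set₁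
  IsWeakRectangulotope   P = MaximalConesAre P weakCone
  IsStrongRectangulotope P = MaximalConesAre P strongCone

  nonemptyProperSubsets : ℕ → Setoid 0ℓ 0ℓ
  nonemptyProperSubsets n =
    On.setoid {B = Σ[ X ∈ Subset n ] (Nonempty X × X ⊂ ⊤)} (≡.setoid (Subset n)) proj₁

  indicator : ∀ {n} → Subset n → Vector Carrier n
  indicator X i = if Vec.lookup X i then 1# else 0#

  -- The normal vectors of a facet form a ray modulo the line spanned by
  -- (1, …, 1), and v is the outer normal vector up to positive scaling.

  HasOuterNormal : ∀ {n} → Polytope n → Pred (Vector Carrier n) 0ℓ → Vector Carrier n → Set
  HasOuterNormal P F v =
    NormalCone P F ≐ λ w → ∃[ a ] ∃[ b ] (0# ≤ a × (∀ i → w i ≈ a * v i + b))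

  HasFacetCount : ∀ {n} → Polytope n → ℕ → Set₁
  HasFacetCount P m = Bijection (Fin.≡-setoid m) (facets P)

  FacetsIndexedBySubsets : ∀ {n} → Polytope n → Set₁
  FacetsIndexedBySubsets {n} P =
    Σ[ f ∈ Bijection (nonemptyProperSubsets n) (facets P) ]
      (∀ X → HasOuterNormal P (proj₁ (Bijection.to f X)) (indicator (proj₁ X)))

{-# OPTIONS --safe #-}
module Submission where

-- For every subset X of the labels there is a rectangulation, built by cutting
-- off one rectangle after the other, in whose weak and strong posets X is an
-- up-set and both X and its complement are connected.  So the indicator e X
-- lies in a maximal cone, and if w is normal to the face maximising e X, then
-- w and e X - δ w (for some δ > 0) lie in that cone too, which forces w to be
-- constant on X and on its complement.  Hence the normal cone of that face is
-- the ray of e X modulo (1, …, 1), and the face is a facet.  Conversely, a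
-- normal v of a facet F lies in the cone of some poset; with X the set where v
-- is not minimal, e X and v - ε e X lie in this cone as well, so F is contained
-- in, and by dimension equal to, the facet maximising e X.

open import Defs
open import Algebra.Bundles using (CommutativeRing)
import Algebra.Properties.Ring
import Algebra.Properties.Semiring.Mult.TCOptimised
import Algebra.Properties.Semiring.Sum
import Algebra.Solver.Ring
import Algebra.Solver.Ring.AlmostCommutativeRing as ACR
open import Data.Bool.Base using (Bool; true; false; if_then_else_; not)
import Data.Bool.Properties as Bool
open import Data.Fin.Base as Fin using (Fin; toℕ; fromℕ<; punchIn; punchOut; _↑ˡ_; _↑ʳ_; splitAt)
open import Data.Fin.Patterns using (0F; 1F; 2F; 3F)
import Data.Fin.Properties as Fin
open import Data.Fin.Subset as Subset using (Subset; Nonempty; ⊤; _⊂_)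
import Data.Fin.Subset.Properties as Subset
open import Data.Integer.Base as ℤ using (ℤ; +_; -[1+_])
import Data.Integer.Properties as ℤ
open import Data.Maybe.Base using (just; nothing)
open import Data.Nat.Base as ℕ using (ℕ; zero; suc; s≤s; z≤n; _∸_; _^_)
import Data.Nat.Properties as ℕ
open import Data.Product.Base using (Σ-syntax; _×_; ∃; ∃-syntax; _,_; proj₁; proj₂)
open import Data.Product.Function.NonDependent.Propositional using (_×-↔_)
import Data.Sign.Base as Sign
open import Data.Sum.Base as Sum using (_⊎_; inj₁; inj₂)
import Data.Unit.Base as Unit
open import Data.Vec.Base as Vec using (Vec; lookup; tabulate)
import Data.Vec.Properties as Vec
open import Data.Vec.Functional as Vector using (Vector)
import Data.Vec.Functional.Properties as Vectorₚ
open import Function.Base using (_∘_; flip; id; case_of_)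
open import Function.Bundles using (Bijection; Inverse; _↔_; mk↔ₛ′; mk⇔)
import Function.Construct.Composition as Composition
open import Function.Definitions using (Injective)
open import Function.Properties.Inverse using (↔-trans)
open import Level using (0ℓ)
open import Relation.Binary.Bundles using (Poset; Setoid)
open import Relation.Binary.Construct.Closure.Transitive as Plus using (TransClosure; [_])
open import Relation.Binary.Core using (Rel)
open import Relation.Binary.Definitions using (WeaklyDecidable; tri<; tri≈; tri>)
open import Relation.Binary.PropositionalEquality as ≡ using (_≡_; _≢_)
import Relation.Binary.Reasoning.PartialOrder
import Relation.Binary.Reasoning.Setoid
open import Relation.Binary.Structures using (IsDecTotalOrder)
open import Relation.Nullary using (¬_; yes; no; contradiction; does; ¬?; _×-dec_)
open import Relation.Nullary.Decidable using (dec-true; dec-false)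
open import Relation.Unary using (Pred; _∈_; _⊆_; _≐_)

-- The polytope is known only through the maximal cones of its normal fan: neither inequalities nor
-- a dimension are given. So every statement about faces becomes one about maximizers of
-- functionals, and the usual passage to a relative interior becomes a perturbation v + δ u with a
-- single δ > 0, which exists because the polytope is the hull of finitely many points. The posets
-- enter only through two properties of one rectangulation for each X, so the weak and the strong
-- case share one argument. These properties dictate the construction: members of X become rows cut
-- off from the top, the others columns cut off from the left. Every row then reaches the right side
-- of the square and every column its bottom, which keeps relations from leading from a row to a
-- column, while rows are stacked on rows and columns stand beside columns. What is left over lies
-- below a row and to the right of a column, so the order of cutting is the required label order.
-- The choice X = [n] puts all labels into one class, which yields the dimension n - 1.

module IntegerCoefficientSolver {c ℓ} (R : CommutativeRing c ℓ) where
  open CommutativeRing R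
  open Algebra.Properties.Ring ring
  open Algebra.Properties.Semiring.Mult.TCOptimised semiring
    renaming (_×_ to _·_)
  open Relation.Binary.Reasoning.Setoid setoid

  private
    -- Coefficients are integers because their equality is decided by computation, whereas equality
    -- in an abstract ring does not compute.
    fromℤ : ℤ → Carrier
    fromℤ (+ n)    = n · 1#
    fromℤ -[1+ n ] = - (suc n · 1#)

    -0≈0 : - 0# ≈ 0#
    -0≈0 = -0#≈0#

    cancel-1 : ∀ a b → (1# + a) - (1# + b) ≈ a - b
    cancel-1 a b = begin
      (1# + a) - (1# + b)         ≈⟨ +-congʳ (+-comm 1# a) ⟩
      (a + 1#) - (1# + b)         ≈⟨ +-congˡ (-‿+-comm 1# b) ⟨
      (a + 1#) + (- 1# + - b)     ≈⟨ +-assoc a 1# _ ⟩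
      a + (1# + (- 1# + - b))     ≈⟨ +-congˡ (+-assoc 1# (- 1#) (- b)) ⟨
      a + ((1# - 1#) + - b)       ≈⟨ +-congˡ (+-congʳ (-‿inverseʳ 1#)) ⟩
      a + (0# + - b)              ≈⟨ +-congˡ (+-identityˡ (- b)) ⟩
      a - b                       ∎

    ⊖-homo : ∀ m n → fromℤ (m ℤ.⊖ n) ≈ m · 1# - n · 1#
    ⊖-homo m       zero    = sym (trans (+-congˡ -0≈0) (+-identityʳ _))
    ⊖-homo zero    (suc n) = sym (+-identityˡ _)
    ⊖-homo (suc m) (suc n) = begin
      fromℤ (suc m ℤ.⊖ suc n)         ≡⟨ ≡.cong fromℤ (ℤ.[1+m]⊖[1+n]≡m⊖n m n) ⟩
      fromℤ (m ℤ.⊖ n)                 ≈⟨ ⊖-homo m n ⟩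
      m · 1# - n · 1#                 ≈⟨ cancel-1 _ _ ⟨
      (1# + m · 1#) - (1# + n · 1#)   ≈⟨ +-cong (1+× m 1#) (-‿cong (1+× n 1#)) ⟨
      suc m · 1# - suc n · 1#         ∎

    +-homo : ∀ i j → fromℤ (i ℤ.+ j) ≈ fromℤ i + fromℤ j
    +-homo (+ m)    (+ n)    = ×-homo-+ 1# m n
    +-homo (+ m)    -[1+ n ] = ⊖-homo m (suc n)
    +-homo -[1+ m ] (+ n)    = trans (⊖-homo n (suc m)) (+-comm _ _)
    +-homo -[1+ m ] -[1+ n ] = begin
      - (suc (suc (m ℕ.+ n)) · 1#)        ≡⟨ ≡.cong (λ k → - (suc k · 1#)) (ℕ.+-suc m n) ⟨
      - ((suc m ℕ.+ suc n) · 1#)          ≈⟨ -‿cong (×-homo-+ 1# (suc m) (suc n)) ⟩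
      - (suc m · 1# + suc n · 1#)         ≈⟨ -‿+-comm _ _ ⟨
      - (suc m · 1#) + - (suc n · 1#)     ∎

    +◃-homo : ∀ n → fromℤ (Sign.+ ℤ.◃ n) ≈ n · 1#
    +◃-homo n = reflexive (≡.cong fromℤ (ℤ.+◃n≡+n n))

    -◃-homo : ∀ n → fromℤ (Sign.- ℤ.◃ n) ≈ - (n · 1#)
    -◃-homo zero    = sym -0≈0
    -◃-homo (suc n) = refl

    *-homo : ∀ i j → fromℤ (i ℤ.* j) ≈ fromℤ i * fromℤ j
    *-homo (+ m)    (+ n)    = trans (+◃-homo (m ℕ.* n)) (×1-homo-* m n)
    *-homo (+ m)    -[1+ n ] = begin
      fromℤ (Sign.- ℤ.◃ (m ℕ.* suc n))   ≈⟨ -◃-homo (m ℕ.* suc n) ⟩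
      - ((m ℕ.* suc n) · 1#)             ≈⟨ -‿cong (×1-homo-* m (suc n)) ⟩
      - (m · 1# * suc n · 1#)            ≈⟨ -‿distribʳ-* _ _ ⟩
      m · 1# * - (suc n · 1#)            ∎
    *-homo -[1+ m ] (+ n)    = begin
      fromℤ (Sign.- ℤ.◃ (suc m ℕ.* n))   ≈⟨ -◃-homo (suc m ℕ.* n) ⟩
      - ((suc m ℕ.* n) · 1#)             ≈⟨ -‿cong (×1-homo-* (suc m) n) ⟩
      - (suc m · 1# * n · 1#)            ≈⟨ -‿distribˡ-* _ _ ⟩
      - (suc m · 1#) * n · 1#            ∎
    *-homo -[1+ m ] -[1+ n ] = begin
      (suc m ℕ.* suc n) · 1#             ≈⟨ ×1-homo-* (suc m) (suc n) ⟩
      suc m · 1# * suc n · 1#            ≈⟨ -‿involutive _ ⟨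
      - - (suc m · 1# * suc n · 1#)      ≈⟨ -‿cong (-‿distribˡ-* _ _) ⟩
      - (- (suc m · 1#) * suc n · 1#)    ≈⟨ -‿distribʳ-* _ _ ⟩
      - (suc m · 1#) * - (suc n · 1#)    ∎

    -‿homo : ∀ i → fromℤ (ℤ.- i) ≈ - fromℤ i
    -‿homo (+ zero)  = sym -0≈0
    -‿homo (+ suc n) = refl
    -‿homo -[1+ n ]  = sym (-‿involutive _)

    morphism : ℤ.+-*-rawRing ACR.-Raw-AlmostCommutative⟶ ACR.fromCommutativeRing R
    morphism = record
      { ⟦_⟧    = fromℤ
      ; +-homo = +-homo
      ; *-homo = *-homo
      ; -‿homo = -‿homo
      ; 0-homo = refl
      ; 1-homo = refl
      }

    _coeff≟_ : WeaklyDecidable (ACR.Induced-equivalence morphism)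
    i coeff≟ j with i ℤ.≟ j
    ... | yes i≡j = just (reflexive (≡.cong fromℤ i≡j))
    ... | no  _   = nothing

  open Algebra.Solver.Ring ℤ.+-*-rawRing (ACR.fromCommutativeRing R) morphism _coeff≟_ public
    using (solve; _:+_; _:*_; _:-_; :-_; _:=_; con)

-- Arithmetic of ordered fields.

module OrderedField (ℝ : RealNumbers) where
  open RealNumbers ℝ public hiding (zero)
  open IntegerCoefficientSolver commutativeRing public
  open IsDecTotalOrder isDecTotalOrder public
    using (_≟_; _≤?_; total; antisym; ≤-resp-≈; isPartialOrder)
    renaming (refl to ≤-refl; reflexive to ≤-reflexive; trans to ≤-trans)

  ≤-poset : Poset 0ℓ 0ℓ 0ℓ
  ≤-poset = record { isPartialOrder = isPartialOrder }

  module ≤-Reasoning = Relation.Binary.Reasoning.PartialOrder ≤-poset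
  module ≈-Reasoning = Relation.Binary.Reasoning.Setoid setoid

  ≤-resp₂ : ∀ {x x′ y y′} → x ≈ x′ → y ≈ y′ → x ≤ y → x′ ≤ y′
  ≤-resp₂ x≈x′ y≈y′ x≤y = ≤-trans (≤-reflexive (sym x≈x′)) (≤-trans x≤y (≤-reflexive y≈y′))

  ≰⇒> : ∀ {x y} → ¬ (x ≤ y) → y < x
  ≰⇒> {x} {y} x≰y with total x y
  ... | inj₁ x≤y = contradiction x≤y x≰y
  ... | inj₂ y≤x = y≤x , λ y≈x → x≰y (≤-reflexive (sym y≈x))

  <⇒≱ : ∀ {x y} → x < y → ¬ (y ≤ x)
  <⇒≱ (x≤y , x≉y) y≤x = x≉y (antisym x≤y y≤x)

  +-mono-≤ : ∀ {x y u v} → x ≤ y → u ≤ v → x + u ≤ y + v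
  +-mono-≤ {x} {y} {u} {v} x≤y u≤v =
    ≤-trans (+-monoʳ-≤ x u≤v) (≤-resp₂ (+-comm v x) (+-comm v y) (+-monoʳ-≤ v x≤y))

  +-cancelʳ-≤ : ∀ {x y} z → x + z ≤ y + z → x ≤ y
  +-cancelʳ-≤ {x} {y} z le = ≤-resp₂
    (solve 2 (λ x z → :- z :+ (x :+ z) := x) refl x z)
    (solve 2 (λ y z → :- z :+ (y :+ z) := y) refl y z)
    (+-monoʳ-≤ (- z) le)

  ≤⇒0≤- : ∀ {x y} → x ≤ y → 0# ≤ y - x
  ≤⇒0≤- {x} {y} x≤y = +-cancelʳ-≤ x (≤-resp₂
    (solve 1 (λ x → x := con (+ 0) :+ x) refl x)
    (solve 2 (λ x y → y := (y :- x) :+ x) refl x y) x≤y)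

  0≤-⇒≤ : ∀ {x y} → 0# ≤ y - x → x ≤ y
  0≤-⇒≤ {x} {y} le = ≤-resp₂
    (solve 1 (λ x → x :+ con (+ 0) := x) refl x)
    (solve 2 (λ x y → x :+ (y :- x) := y) refl x y) (+-monoʳ-≤ x le)

  -‿anti-≤ : ∀ {x y} → x ≤ y → - y ≤ - x
  -‿anti-≤ {x} {y} x≤y = 0≤-⇒≤ (≤-resp₂ refl
    (solve 2 (λ x y → y :- x := :- x :- :- y) refl x y) (≤⇒0≤- x≤y))

  -‿anti-≤⁻¹ : ∀ {x y} → - y ≤ - x → x ≤ y
  -‿anti-≤⁻¹ {x} {y} le = ≤-resp₂ (double x) (double y) (-‿anti-≤ le)
    where
    double : ∀ x → - - x ≈ x
    double = solve 1 (λ x → :- :- x := x) refl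

  *-monoˡ-≤ : ∀ {c x y} → 0# ≤ c → x ≤ y → c * x ≤ c * y
  *-monoˡ-≤ {c} {x} {y} 0≤c x≤y = 0≤-⇒≤ (≤-resp₂ refl
    (solve 3 (λ c x y → c :* (y :- x) := c :* y :- c :* x) refl c x y)
    (*-nonNegative 0≤c (≤⇒0≤- x≤y)))

  -- Otherwise 0 - 1 is nonnegative, and then so is its square, which is 1.
  0≤1 : 0# ≤ 1#
  0≤1 with total 0# 1#
  ... | inj₁ 0≤1 = 0≤1
  ... | inj₂ 1≤0 = ≤-resp₂ refl (solve 0 ((con (+ 0) :- con (+ 1)) :* (con (+ 0) :- con (+ 1)) := con (+ 1)) refl)
                    (*-nonNegative (≤⇒0≤- 1≤0) (≤⇒0≤- 1≤0))

  0<1 : 0# < 1#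
  0<1 = 0≤1 , 0≉1

  <-+1 : ∀ x → x < x + 1#
  <-+1 x = ≤-resp₂ (+-identityʳ x) refl (+-monoʳ-≤ x 0≤1) , λ x≈x+1 → 0≉1 (begin
    0#              ≈⟨ -‿inverseˡ x ⟨
    - x + x         ≈⟨ +-congˡ x≈x+1 ⟩
    - x + (x + 1#)  ≈⟨ solve 1 (λ x → :- x :+ (x :+ con (+ 1)) := con (+ 1)) refl x ⟩
    1#              ∎)
    where open ≈-Reasoning

  *-cancel-0 : ∀ {x y} → x * y ≈ 0# → ¬ (x ≈ 0#) → y ≈ 0#
  *-cancel-0 {x} {y} xy≈0 x≉0 = let x⁻¹ , xx⁻¹≈1 = inverse x x≉0 in begin
    y               ≈⟨ *-identityˡ y ⟨
    1# * y          ≈⟨ *-congʳ xx⁻¹≈1 ⟨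
    (x * x⁻¹) * y   ≈⟨ solve 3 (λ x z y → (x :* z) :* y := z :* (x :* y)) refl x x⁻¹ y ⟩
    x⁻¹ * (x * y)   ≈⟨ *-congˡ xy≈0 ⟩
    x⁻¹ * 0#        ≈⟨ zeroʳ x⁻¹ ⟩
    0#              ∎
    where open ≈-Reasoning

  positive-inverse : ∀ {x} → 0# < x → ∃[ y ] (0# < y × x * y ≈ 1#)
  positive-inverse {x} (0≤x , 0≉x) with inverse x (0≉x ∘ sym)
  ... | y , xy≈1 with total 0# y
  ...   | inj₁ 0≤y = y , (0≤y , λ 0≈y → 0≉1 (trans (sym (trans (*-congˡ (sym 0≈y)) (zeroʳ x))) xy≈1)) , xy≈1
  ...   | inj₂ y≤0 = contradiction
    (≤-resp₂ (trans (*-congˡ refl) xy≈1) (zeroʳ x) (*-monoˡ-≤ 0≤x y≤0)) (<⇒≱ 0<1)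

  *-cancelˡ-≤ : ∀ {c x y} → 0# < c → c * x ≤ c * y → x ≤ y
  *-cancelˡ-≤ {c} {x} {y} 0<c cx≤cy with positive-inverse 0<c
  ... | d , (0≤d , _) , cd≈1 = ≤-resp₂ (undo x) (undo y) (*-monoˡ-≤ 0≤d cx≤cy)
    where
    undo : ∀ z → d * (c * z) ≈ z
    undo z = trans (solve 3 (λ c d z → d :* (c :* z) := (c :* d) :* z) refl c d z)
                   (trans (*-congʳ cd≈1) (*-identityˡ z))

  x-y≈0⇒x≈y : ∀ {x y} → x - y ≈ 0# → x ≈ y
  x-y≈0⇒x≈y {x} {y} x-y≈0 = begin
    x            ≈⟨ solve 2 (λ x y → x := (x :- y) :+ y) refl x y ⟩
    (x - y) + y  ≈⟨ +-congʳ x-y≈0 ⟩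
    0# + y       ≈⟨ +-identityˡ y ⟩
    y            ∎
    where open ≈-Reasoning

-- Cut positions of the separating rectangulation, as natural numbers.

count : ∀ {n} → Bool → Vec Bool n → ℕ → ℕ
count c xs       zero    = 0
count c Vec.[]     (suc k) = 0
count c (x Vec.∷ xs) (suc k) = (if does (x Bool.≟ c) then 1 else 0) ℕ.+ count c xs k

count-mono : ∀ {n} c (xs : Vec Bool n) {k l} → k ℕ.≤ l → count c xs k ℕ.≤ count c xs l
count-mono c xs       z≤n       = z≤n
count-mono c Vec.[]     (s≤s k≤l) = z≤n
count-mono c (x Vec.∷ xs) (s≤s k≤l) = ℕ.+-monoʳ-≤ (if does (x Bool.≟ c) then 1 else 0) (count-mono c xs k≤l)

count≤ : ∀ {n} c (xs : Vec Bool n) k → count c xs k ℕ.≤ k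
count≤ c xs       zero    = z≤n
count≤ c Vec.[]     (suc k) = z≤n
count≤ c (x Vec.∷ xs) (suc k) with does (x Bool.≟ c)
... | true  = s≤s (count≤ c xs k)
... | false = ℕ.m≤n⇒m≤1+n (count≤ c xs k)

count-suc : ∀ {n} c (xs : Vec Bool n) i → lookup xs i ≡ c →
            count c xs (suc (toℕ i)) ≡ suc (count c xs (toℕ i))
count-suc c (x Vec.∷ xs) Fin.zero    x≡c with x Bool.≟ c
... | yes _   = ≡.refl
... | no  x≢c = contradiction x≡c x≢c
count-suc c (x Vec.∷ xs) (Fin.suc i) eq with does (x Bool.≟ c)
... | true  = ≡.cong suc (count-suc c xs i eq)
... | false = count-suc c xs i eq

count-skip : ∀ {n} c (xs : Vec Bool n) i → lookup xs i ≢ c →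
             count c xs (suc (toℕ i)) ≡ count c xs (toℕ i)
count-skip c (x Vec.∷ xs) Fin.zero    x≢c with x Bool.≟ c
... | yes x≡c = contradiction x≡c x≢c
... | no  _   = ≡.refl
count-skip c (x Vec.∷ xs) (Fin.suc i) neq with does (x Bool.≟ c)
... | true  = ≡.cong suc (count-skip c xs i neq)
... | false = count-skip c xs i neq

-- The rectangulation in which label i cuts off the left column of what the
-- labels below i have left over, or its top row if i belongs to X; the last
-- label takes the remainder.  With colour c = false for columns and c = true
-- for rows, rectangle i occupies [ near false i , far false i ] from the left
-- and [ near true i , far true i ] from the top.

module Corner {m : ℕ} (X : Vec Bool (suc m)) where

  -- Each earlier cut of colour c has moved the corner of the left-over region by one unit. Only
  -- labels below m cut, so no cut line reaches `suc m`, and that value of `far` marks a side on the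
  -- boundary of the square.
  near far : Bool → Fin (suc m) → ℕ
  near c i = count c X (toℕ i)
  far  c i with lookup X i Bool.≟ c ×-dec toℕ i ℕ.<? m
  ... | yes _ = suc (near c i)
  ... | no  _ = suc m

  far-cut : ∀ {c i} → lookup X i ≡ c → toℕ i ℕ.< m → far c i ≡ suc (near c i)
  far-cut {c} {i} i≡c i<m with lookup X i Bool.≟ c ×-dec toℕ i ℕ.<? m
  ... | yes _ = ≡.refl
  ... | no ¬p = contradiction (i≡c , i<m) ¬p

  far-whole : ∀ {c i} → ¬ (lookup X i ≡ c × toℕ i ℕ.< m) → far c i ≡ suc m
  far-whole {c} {i} ¬cut with lookup X i Bool.≟ c ×-dec toℕ i ℕ.<? m
  ... | yes p = contradiction p ¬cut
  ... | no  _ = ≡.refl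

  far-cut⁻¹ : ∀ {c i} → far c i ≢ suc m → lookup X i ≡ c × toℕ i ℕ.< m
  far-cut⁻¹ {c} {i} far≢ with lookup X i Bool.≟ c ×-dec toℕ i ℕ.<? m
  ... | yes p = p
  ... | no  _ = contradiction ≡.refl far≢

  near<1+m : ∀ c i → near c i ℕ.< suc m
  near<1+m c i = ℕ.≤-<-trans (count≤ c X (toℕ i)) (Fin.toℕ<n i)

  near<far : ∀ c i → near c i ℕ.< far c i
  near<far c i with lookup X i Bool.≟ c ×-dec toℕ i ℕ.<? m
  ... | yes _ = ℕ.n<1+n _
  ... | no  _ = near<1+m c i

  far≤1+m : ∀ c i → far c i ℕ.≤ suc m
  far≤1+m c i with lookup X i Bool.≟ c ×-dec toℕ i ℕ.<? m
  ... | yes _ = near<1+m c i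
  ... | no  _ = ℕ.≤-refl

  near-mono : ∀ c {i j} → toℕ i ℕ.≤ toℕ j → near c i ℕ.≤ near c j
  near-mono c = count-mono c X

  <⇒<m : ∀ {i j : Fin (suc m)} → i Fin.< j → toℕ i ℕ.< m
  <⇒<m {i} {j} i<j = ℕ.<-≤-trans i<j (ℕ.≤-pred (Fin.toℕ<n j))

  far-count : ∀ {c i} → lookup X i ≡ c → toℕ i ℕ.< m → far c i ≡ count c X (suc (toℕ i))
  far-count {c} {i} i≡c i<m = ≡.trans (far-cut i≡c i<m) (≡.sym (count-suc c X i i≡c))

  far≤near : ∀ {c i j} → lookup X i ≡ c → i Fin.< j → far c i ℕ.≤ near c j
  far≤near {c} {i} {j} i≡c i<j = ℕ.≤-trans
    (ℕ.≤-reflexive (far-count i≡c (<⇒<m {i} {j} i<j))) (count-mono c X i<j)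

  far≡near⇒< : ∀ {c i j} → far c i ≡ near c j → i Fin.< j
  far≡near⇒< {c} {i} {j} eq = ℕ.≰⇒> λ j≤i →
    ℕ.<⇒≱ (near<far c i) (ℕ.≤-trans (ℕ.≤-reflexive eq) (near-mono c j≤i))

  far-injective : ∀ {c i j} → lookup X i ≡ c → lookup X j ≡ c → far c i ≡ far c j → i ≡ j
  far-injective {c} {i} {j} i≡c j≡c eq with Fin.<-cmp i j
  ... | tri≈ _ i≡j _ = i≡j
  ... | tri< i<j _ _ = contradiction (ℕ.≤-trans (ℕ.≤-reflexive (≡.sym eq)) (far≤near i≡c i<j)) (ℕ.<⇒≱ (near<far c j))
  ... | tri> _ _ j<i = contradiction (ℕ.≤-trans (ℕ.≤-reflexive eq) (far≤near j≡c j<i)) (ℕ.<⇒≱ (near<far c i))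

  -- This makes segments end where they should: a rectangle with an edge on the cut line of i is cut
  -- off no earlier than i, so in the other direction it starts no nearer than i does.
  far-meets : ∀ {c i k} → far c i ≢ suc m → near c k ≡ far c i ⊎ far c k ≡ far c i →
              toℕ i ℕ.≤ toℕ k
  far-meets         cut (inj₁ eq) = ℕ.<⇒≤ (far≡near⇒< (≡.sym eq))
  far-meets {c} {i} cut (inj₂ eq) = ℕ.≤-reflexive (≡.cong toℕ
    (far-injective (proj₁ (far-cut⁻¹ cut)) (proj₁ (far-cut⁻¹ λ e → cut (≡.trans (≡.sym eq) e))) (≡.sym eq)))

  -- The walk upwards from i remembers the last label k of colour c that it met. Labels of the other
  -- colour leave `count c` unchanged, so the far side of k is still the near side of whatever comes
  -- next. `G` is what a step demands of its target: nothing when j may have any colour, colour c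
  -- when the steps must stay within it.
  chain : ∀ {c} {S : Rel (Fin (suc m)) 0ℓ} {G : Fin (suc m) → Set} →
          (∀ {k} → lookup X k ≡ c → G k) →
          (∀ {i j} → lookup X i ≡ c → G j → far c i ≡ near c j → S i j) →
          ∀ {i j} → lookup X i ≡ c → G j → i Fin.< j → TransClosure S i j
  chain {c} {S} {G} colour⇒G step {i} {j} i≡c Gj i<j = extend (reach (ℕ.≤⇒≤′ i<j) (ℕ.<⇒≤ (Fin.toℕ<n j))) ≡.refl Gj
    where
    Reached : ℕ → Set
    Reached l = ∃[ k ] ( lookup X k ≡ c × toℕ k ℕ.< l
                       × count c X (suc (toℕ k)) ≡ count c X l
                       × (i ≡ k ⊎ TransClosure S i k))

    extend : ∀ {l} → Reached l → ∀ {j} → toℕ j ≡ l → G j → TransClosure S i j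
    extend (k , k≡c , k<l , eq , i⇝k) {j} ≡.refl Gj with i⇝k
    ... | inj₁ ≡.refl = [ k⟶j ]
      where k⟶j = step k≡c Gj (≡.trans (far-count k≡c (<⇒<m {k} {j} k<l)) eq)
    ... | inj₂ i⇝k    = i⇝k Plus.∷ʳ k⟶j
      where k⟶j = step k≡c Gj (≡.trans (far-count k≡c (<⇒<m {k} {j} k<l)) eq)

    reach : ∀ {l} → suc (toℕ i) ℕ.≤′ l → l ℕ.≤ suc m → Reached l
    reach ℕ.≤′-refl _ = i , i≡c , ℕ.n<1+n _ , ≡.refl , inj₁ ≡.refl
    reach (ℕ.≤′-step {l} i<l) l<n with reach i<l (ℕ.<⇒≤ l<n) | lookup X (fromℕ< l<n) Bool.≟ c
    ... | r                       | yes l≡c =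
      fromℕ< l<n , l≡c , s≤s (ℕ.≤-reflexive toℕ≡) , ≡.cong (λ k → count c X (suc k)) toℕ≡
      , inj₂ (extend r toℕ≡ (colour⇒G l≡c))
      where toℕ≡ = Fin.toℕ-fromℕ< l<n
    ... | k , k≡c , k<l , eq , i⇝k | no l≢c =
      k , k≡c , ℕ.m≤n⇒m≤1+n k<l
      , ≡.trans eq (≡.sym (≡.subst (λ l → count c X (suc l) ≡ count c X l) toℕ≡ (count-skip c X (fromℕ< l<n) l≢c)))
      , i⇝k
      where toℕ≡ = Fin.toℕ-fromℕ< l<n

-- Natural numbers inside the ordered field.

module NaturalNumbersIn (ℝ : RealNumbers) where
  open OrderedField ℝ

  ι : ℕ → Carrier
  ι zero    = 0#
  ι (suc k) = ι k + 1#

  ι-mono-≤ : ∀ {j k} → j ℕ.≤ k → ι j ≤ ι k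
  ι-mono-≤ {zero}  {zero}  z≤n       = ≤-refl
  ι-mono-≤ {zero}  {suc k} z≤n       = ≤-trans (ι-mono-≤ {zero} {k} z≤n) (proj₁ (<-+1 (ι k)))
  ι-mono-≤ {suc j} {suc k} (s≤s j≤k) = +-mono-≤ (ι-mono-≤ j≤k) ≤-refl

  ι-cancel-≤ : ∀ {j k} → ι j ≤ ι k → j ℕ.≤ k
  ι-cancel-≤ {j} {k} ιj≤ιk = ℕ.≮⇒≥ λ k<j →
    <⇒≱ (<-+1 (ι k)) (≤-trans (ι-mono-≤ k<j) ιj≤ιk)

  ι-injective : ∀ {j k} → ι j ≈ ι k → j ≡ k
  ι-injective eq = ℕ.≤-antisym (ι-cancel-≤ (≤-reflexive eq)) (ι-cancel-≤ (≤-reflexive (sym eq)))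

  ι-mono-< : ∀ {j k} → j ℕ.< k → ι j < ι k
  ι-mono-< j<k = ι-mono-≤ (ℕ.<⇒≤ j<k) , λ eq → ℕ.<⇒≢ j<k (ι-injective eq)

  -ι-mono-≤ : ∀ {j k} → j ℕ.≤ k → - ι k ≤ - ι j
  -ι-mono-≤ j≤k = -‿anti-≤ (ι-mono-≤ j≤k)

  -ι-cancel-≤ : ∀ {j k} → - ι k ≤ - ι j → j ℕ.≤ k
  -ι-cancel-≤ le = ι-cancel-≤ (-‿anti-≤⁻¹ le)

  -ι-injective : ∀ {j k} → - ι j ≈ - ι k → j ≡ k
  -ι-injective eq = ℕ.≤-antisym (-ι-cancel-≤ (≤-reflexive (sym eq))) (-ι-cancel-≤ (≤-reflexive eq))

  -ι-mono-< : ∀ {j k} → j ℕ.< k → - ι k < - ι j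
  -ι-mono-< j<k = -ι-mono-≤ (ℕ.<⇒≤ j<k) , λ eq → ℕ.<⇒≢ j<k (≡.sym (-ι-injective eq))

-- The separating rectangulation in the plane.

module CornerRectangulation (ℝ : RealNumbers) {m : ℕ} (X : Vec Bool (suc m)) where
  open OrderedField ℝ
  open NaturalNumbersIn ℝ
  open Corner X

  n = suc m


  -- Labels increase from top to bottom while the y-axis points upwards, so the top side is at
  -- height 0 and depths become y-coordinates by negation.
  square : Rectangle ℝ
  square = record
    { lo    = λ { x-axis → ι 0 ; y-axis → - ι n }
    ; hi    = λ { x-axis → ι n ; y-axis → - ι 0 }
    ; lo<hi = λ { x-axis → ι-mono-< {0} {n} (s≤s z≤n) ; y-axis → -ι-mono-< {0} {n} (s≤s z≤n) }
    }

  rect : Fin n → Rectangle ℝ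
  rect i = record
    { lo    = λ { x-axis → ι (near false i) ; y-axis → - ι (far true i) }
    ; hi    = λ { x-axis → ι (far false i)  ; y-axis → - ι (near true i) }
    ; lo<hi = λ { x-axis → ι-mono-< (near<far false i) ; y-axis → -ι-mono-< (near<far true i) }
    }

  -- Measuring from the left and from the top lets one argument, indexed by the colour, treat both
  -- axes.
  depth : Bool → Point ℝ → Carrier
  depth false p = p x-axis
  depth true  p = - p y-axis

  InsideByDepth : Fin n → Point ℝ → Set
  InsideByDepth i p = ∀ c → ι (near c i) ≤ depth c p × depth c p ≤ ι (far c i)

  private
    neg-involutive : ∀ x → - - x ≈ x
    neg-involutive = solve 1 (λ x → :- :- x := x) refl

    -≤⇒-≤ : ∀ {x y} → - x ≤ y → - y ≤ x
    -≤⇒-≤ {x} le = ≤-trans (-‿anti-≤ le) (≤-reflexive (neg-involutive x))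

    ≤-⇒≤- : ∀ {x y} → x ≤ - y → y ≤ - x
    ≤-⇒≤- {x} {y} le = ≤-trans (≤-reflexive (sym (neg-involutive y))) (-‿anti-≤ le)

  inside⇒byDepth : ∀ {i p} → Inside ℝ (rect i) p → InsideByDepth i p
  inside⇒byDepth in-i false = in-i x-axis
  inside⇒byDepth in-i true  = ≤-⇒≤- (proj₂ (in-i y-axis)) , -≤⇒-≤ (proj₁ (in-i y-axis))

  byDepth⇒inside : ∀ {i p} → InsideByDepth i p → Inside ℝ (rect i) p
  byDepth⇒inside in-i x-axis = in-i false
  byDepth⇒inside in-i y-axis = -≤⇒-≤ (proj₂ (in-i true)) , ≤-⇒≤- (proj₁ (in-i true))

  inside : ∀ i {p} → Inside ℝ (rect i) p → Inside ℝ square p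
  inside i in-i x-axis = ≤-trans (ι-mono-≤ {0} {near false i} z≤n) (proj₁ (in-i x-axis))
                       , ≤-trans (proj₂ (in-i x-axis)) (ι-mono-≤ (far≤1+m false i))
  inside i in-i y-axis = ≤-trans (-ι-mono-≤ (far≤1+m true i)) (proj₁ (in-i y-axis))
                       , ≤-trans (proj₂ (in-i y-axis)) (-ι-mono-≤ {0} {near true i} z≤n)

  covering : ∀ p → Inside ℝ square p → ∃[ i ] Inside ℝ (rect i) p
  covering p in-square = search m 0 (ℕ.+-identityʳ m) λ
    { false → proj₁ (in-square x-axis) ; true → ≤-⇒≤- (proj₂ (in-square y-axis)) }
    where
    depth≤n : ∀ c → depth c p ≤ ι n
    depth≤n false = proj₂ (in-square x-axis)
    depth≤n true  = -≤⇒-≤ (proj₁ (in-square y-axis))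

    within : ∀ i c → (depth c p ≤ ι (suc (near c i)) ⊎ lookup X i ≢ c ⊎ toℕ i ≡ m) → depth c p ≤ ι (far c i)
    within i c cut with far c i ℕ.≟ suc m | cut
    ... | yes far≡ | _ = ≤-trans (depth≤n c) (ι-mono-≤ (ℕ.≤-reflexive (≡.sym far≡)))
    ... | no  far≢ | inj₁ d≤ = let i≡c , i<m = far-cut⁻¹ far≢ in
      ≤-trans d≤ (ι-mono-≤ (ℕ.≤-reflexive (≡.sym (far-cut i≡c i<m))))
    ... | no  far≢ | inj₂ (inj₁ i≢c) = contradiction (proj₁ (far-cut⁻¹ far≢)) i≢c
    ... | no  far≢ | inj₂ (inj₂ i≡m) = contradiction i≡m (ℕ.<⇒≢ (proj₂ (far-cut⁻¹ far≢)))

    -- Invariant: p lies in what the labels below k leave over. Either label k takes p, or p lies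
    -- beyond its cut and the search goes on; the last label takes all that remains. The number d of
    -- cuts still to come makes the recursion structural.
    search : ∀ d k → d ℕ.+ k ≡ m → (∀ c → ι (count c X k) ≤ depth c p) →
             ∃[ i ] Inside ℝ (rect i) p
    search d k d+k≡m past = here d d+k≡m
      where
      k<n : k ℕ.< n
      k<n = s≤s (ℕ.≤-trans (ℕ.m≤n+m k d) (ℕ.≤-reflexive d+k≡m))

      i : Fin n
      i = fromℕ< k<n

      i≡k : toℕ i ≡ k
      i≡k = Fin.toℕ-fromℕ< k<n

      past-i : ∀ c → ι (near c i) ≤ depth c p
      past-i c = ≡.subst (λ k → ι (count c X k) ≤ depth c p) (≡.sym i≡k) (past c)

      here : ∀ d → d ℕ.+ k ≡ m → ∃[ i ] Inside ℝ (rect i) p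
      here zero    k≡m = i , byDepth⇒inside λ c → past-i c , within i c (inj₂ (inj₂ (≡.trans i≡k k≡m)))
      here (suc d) d+k≡m with depth (lookup X i) p ≤? ι (suc (near (lookup X i) i))
      ... | yes d≤ = i , byDepth⇒inside λ c → past-i c , within i c (cut c)
        where
        cut : ∀ c → depth c p ≤ ι (suc (near c i)) ⊎ lookup X i ≢ c ⊎ toℕ i ≡ m
        cut c with lookup X i Bool.≟ c
        ... | yes ≡.refl = inj₁ d≤
        ... | no  i≢c    = inj₂ (inj₁ i≢c)
      ... | no  d≰ = search d (suc k) (≡.trans (ℕ.+-suc d k) d+k≡m) λ c →
        ≡.subst (λ k → ι (count c X (suc k)) ≤ depth c p) i≡k (past-suc c)
        where
        past-suc : ∀ c → ι (count c X (suc (toℕ i))) ≤ depth c p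
        past-suc c with lookup X i Bool.≟ c
        ... | yes ≡.refl = ≤-trans (ι-mono-≤ (ℕ.≤-reflexive (count-suc c X i ≡.refl))) (proj₁ (≰⇒> d≰))
        ... | no  i≢c    = ≤-trans (ι-mono-≤ (ℕ.≤-reflexive (count-skip c X i i≢c))) (past-i c)

  disjoint-< : ∀ {i j} → i Fin.< j → ∀ p →
               ¬ (p ∈ StrictlyInside ℝ (rect i) × p ∈ StrictlyInside ℝ (rect j))
  disjoint-< {i} {j} i<j p (in-i , in-j) with lookup X i in i≡c
  ... | false = <⇒≱ (proj₂ (in-i x-axis))
    (≤-trans (ι-mono-≤ (far≤near {false} {i} {j} i≡c i<j)) (proj₁ (proj₁ (in-j x-axis))))
  ... | true  = <⇒≱ (proj₁ (in-i y-axis))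
    (≤-trans (proj₁ (proj₂ (in-j y-axis))) (-ι-mono-≤ (far≤near {true} {i} {j} i≡c i<j)))

  disjoint : ∀ {i j} → i ≢ j → ∀ p →
             ¬ (p ∈ StrictlyInside ℝ (rect i) × p ∈ StrictlyInside ℝ (rect j))
  disjoint {i} {j} i≢j p (in-i , in-j) with Fin.<-cmp i j
  ... | tri< i<j _ _ = disjoint-< i<j p (in-i , in-j)
  ... | tri≈ _ i≡j _ = i≢j i≡j
  ... | tri> _ _ j<i = disjoint-< j<i p (in-j , in-i)

  -- Of two rectangles with a common point p, the one with the smaller label
  -- has p on the side along which it was cut off, and at most one rectangle
  -- of each colour can have p there.

  OnCut : Point ℝ → Fin n → Set
  OnCut p i = ι (far (lookup X i) i) ≈ depth (lookup X i) p

  onCut-< : ∀ {p i j} → InsideByDepth i p → InsideByDepth j p → i Fin.< j → OnCut p i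
  onCut-< {p} {i} {j} in-i in-j i<j = antisym
    (≤-trans (ι-mono-≤ (far≤near ≡.refl i<j)) (proj₁ (in-j (lookup X i)))) (proj₂ (in-i (lookup X i)))

  onCut : ∀ {p i j} → InsideByDepth i p → InsideByDepth j p → i ≢ j → OnCut p i ⊎ OnCut p j
  onCut {p} {i} {j} in-i in-j i≢j with Fin.<-cmp i j
  ... | tri< i<j _ _ = inj₁ (onCut-< in-i in-j i<j)
  ... | tri≈ _ i≡j _ = contradiction i≡j i≢j
  ... | tri> _ _ j<i = inj₂ (onCut-< in-j in-i j<i)

  onCut-injective : ∀ {p i j} → OnCut p i → OnCut p j → lookup X i ≡ lookup X j → i ≡ j
  onCut-injective {p} {i} {j} cut-i cut-j i≡j = far-injective i≡j ≡.refl
    (ι-injective (trans (≡.subst (λ c → ι (far c i) ≈ depth c p) i≡j cut-i) (sym cut-j)))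

  pigeonhole : ∀ (a b c : Bool) → a ≡ b ⊎ a ≡ c ⊎ b ≡ c
  pigeonhole false false c     = inj₁ ≡.refl
  pigeonhole true  true  c     = inj₁ ≡.refl
  pigeonhole false true  false = inj₂ (inj₁ ≡.refl)
  pigeonhole false true  true  = inj₂ (inj₂ ≡.refl)
  pigeonhole true  false false = inj₂ (inj₂ ≡.refl)
  pigeonhole true  false true  = inj₂ (inj₁ ≡.refl)

  noThreeCuts : ∀ {p i j k} → OnCut p i → OnCut p j → OnCut p k → i ≢ j → i ≢ k → ¬ (j ≢ k)
  noThreeCuts {p} {i} {j} {k} cut-i cut-j cut-k i≢j i≢k j≢k with pigeonhole (lookup X i) (lookup X j) (lookup X k)
  ... | inj₁ eq        = i≢j (onCut-injective cut-i cut-j eq)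
  ... | inj₂ (inj₁ eq) = i≢k (onCut-injective cut-i cut-k eq)
  ... | inj₂ (inj₂ eq) = j≢k (onCut-injective cut-j cut-k eq)

  corner⇒inside : ∀ i {p} → IsCorner ℝ (rect i) p → Inside ℝ (rect i) p
  corner⇒inside i corner a with corner a
  ... | inj₁ p≈lo = ≤-reflexive (sym p≈lo) , ≤-trans (≤-reflexive p≈lo) (proj₁ (Rectangle.lo<hi (rect i) a))
  ... | inj₂ p≈hi = ≤-trans (proj₁ (Rectangle.lo<hi (rect i) a)) (≤-reflexive (sym p≈hi)) , ≤-reflexive p≈hi

  -- Each of the pairs 0, 1 and 2, 3 contains a rectangle with p on its cut, and the two rectangles
  -- not chosen provide a third. Two of the three share a colour, hence a cut line, and so coincide.
  generic : ∀ p (f : Fin 4 → Fin n) → Injective _≡_ _≡_ f →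
            ¬ (∀ k → p ∈ IsCorner ℝ (rect (f k)))
  generic p f f-injective corners =
    case onCut (in-f 0F) (in-f 1F) (λ eq → case f-injective eq of λ ()) of λ
      { (inj₁ cut₀) → case onCut (in-f 2F) (in-f 3F) (λ eq → case f-injective eq of λ ()) of λ
        { (inj₁ cut₂) → third 0F 2F 1F 3F cut₀ cut₂ (λ ()) (λ ()) (λ ()) (λ ()) (λ ()) (λ ())
        ; (inj₂ cut₃) → third 0F 3F 1F 2F cut₀ cut₃ (λ ()) (λ ()) (λ ()) (λ ()) (λ ()) (λ ()) }
      ; (inj₂ cut₁) → case onCut (in-f 2F) (in-f 3F) (λ eq → case f-injective eq of λ ()) of λ
        { (inj₁ cut₂) → third 1F 2F 0F 3F cut₁ cut₂ (λ ()) (λ ()) (λ ()) (λ ()) (λ ()) (λ ())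
        ; (inj₂ cut₃) → third 1F 3F 0F 2F cut₁ cut₃ (λ ()) (λ ()) (λ ()) (λ ()) (λ ()) (λ ()) } }
    where
    in-f : ∀ k → InsideByDepth (f k) p
    in-f k = inside⇒byDepth (corner⇒inside (f k) (corners k))

    third : ∀ a b c d → OnCut p (f a) → OnCut p (f b) →
            a ≢ b → a ≢ c → a ≢ d → b ≢ c → b ≢ d → ¬ (c ≢ d)
    third a b c d cut-a cut-b a≢b a≢c a≢d b≢c b≢d c≢d with onCut (in-f c) (in-f d) (c≢d ∘ f-injective)
    ... | inj₁ cut-c = noThreeCuts cut-a cut-b cut-c (a≢b ∘ f-injective) (a≢c ∘ f-injective) (b≢c ∘ f-injective)
    ... | inj₂ cut-d = noThreeCuts cut-a cut-b cut-d (a≢b ∘ f-injective) (a≢d ∘ f-injective) (b≢d ∘ f-injective)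

  decomposition : Decomposition ℝ n
  decomposition = record
    { square   = square
    ; isSquare = solve 2 (λ o z → z :- o := (:- o) :- (:- z)) refl (ι 0) (ι n)
    ; rect     = rect
    ; inside   = λ i {p} → inside i {p}
    ; covering = covering
    ; disjoint = disjoint
    ; generic  = generic
    }

  -- The right side of column i is a complete segment. It cannot be prolonged downwards because it
  -- ends on the square, nor upwards because every rectangle with an edge on its line has a label at
  -- least i and so does not reach above i.
  commonSegment-x : ∀ {i j} → lookup X i ≡ false → far false i ≡ near false j →
                    CommonSegment ℝ decomposition x-axis i j
  commonSegment-x {i} {j} i≡c adjacent =
    ι (far false i) , - ι n , - ι (near true i) ,
    ( (record
        { p<q      = -ι-mono-< (near<1+m true i)
        ; interior = ι-mono-< (ℕ.≤-<-trans z≤n (near<far false i)) , ι-mono-< far<n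
        ; edges    = λ t p≤t t≤q →
            i , inj₂ refl , (≤-trans (≤-reflexive lo≈) p≤t , t≤q) , (≤-reflexive (sym lo≈) , ≤-refl)
        }
      , maximal)
    , (refl , ≤-reflexive (sym lo≈) , ≤-refl)
    , (reflexive (≡.cong ι (≡.sym adjacent)) , -ι-mono-≤ (far≤1+m true j) , -ι-mono-≤ (near-mono true (ℕ.<⇒≤ i<j))))
    where
    i<j : i Fin.< j
    i<j = far≡near⇒< adjacent

    far<n : far false i ℕ.< n
    far<n = ≡.subst (ℕ._< n) (≡.sym adjacent) (near<1+m false j)

    lo≈ : - ι (far true i) ≈ - ι n
    lo≈ = reflexive (≡.cong (-_ ∘ ι) (far-whole λ (i≡true , _) → case ≡.trans (≡.sym i≡c) i≡true of λ ()))

    maximal : ∀ p′ q′ → ComposedOfEdges ℝ decomposition x-axis (ι (far false i)) p′ q′ →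
              p′ ≤ - ι n → - ι (near true i) ≤ q′ → p′ ≈ - ι n × q′ ≈ - ι (near true i)
    maximal p′ q′ composed p′≤p q≤q′ = antisym p′≤p p≤p′ , antisym q′≤q q≤q′
      where
      open ComposedOfEdges composed

      p≤p′ : - ι n ≤ p′
      p≤p′ with edges p′ ≤-refl (proj₁ p<q)
      ... | k , _ , (lo≤p′ , _) , _ = ≤-trans (-ι-mono-≤ (far≤1+m true k)) lo≤p′

      q′≤q : q′ ≤ - ι (near true i)
      q′≤q with edges q′ (proj₁ p<q) ≤-refl
      ... | k , c-edge , (_ , q′≤hi) , _ = ≤-trans q′≤hi (-ι-mono-≤ (near-mono true
        (far-meets (ℕ.<⇒≢ far<n) (Sum.map (≡.sym ∘ ι-injective) (≡.sym ∘ ι-injective) c-edge))))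

  -- The mirror image of the column case. The arguments change places because along the y-axis the
  -- lower rectangle j comes first.
  commonSegment-y : ∀ {i j} → lookup X i ≡ true → far true i ≡ near true j →
                    CommonSegment ℝ decomposition y-axis j i
  commonSegment-y {i} {j} i≡c adjacent =
    - ι (far true i) , ι (near false i) , ι n ,
    ( (record
        { p<q      = ι-mono-< (near<1+m false i)
        ; interior = -ι-mono-< far<n , -ι-mono-< (ℕ.≤-<-trans z≤n (near<far true i))
        ; edges    = λ t p≤t t≤q →
            i , inj₁ refl , (p≤t , ≤-trans t≤q (≤-reflexive (sym hi≈))) , (≤-refl , ≤-reflexive hi≈)
        }
      , maximal)
    , (reflexive (≡.cong (-_ ∘ ι) (≡.sym adjacent)) , ι-mono-≤ (near-mono false (ℕ.<⇒≤ i<j))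
      , ι-mono-≤ (far≤1+m false j))
    , (refl , ≤-refl , ≤-reflexive hi≈))
    where
    i<j : i Fin.< j
    i<j = far≡near⇒< adjacent

    far<n : far true i ℕ.< n
    far<n = ≡.subst (ℕ._< n) (≡.sym adjacent) (near<1+m true j)

    hi≈ : ι (far false i) ≈ ι n
    hi≈ = reflexive (≡.cong ι (far-whole λ (i≡false , _) → case ≡.trans (≡.sym i≡c) i≡false of λ ()))

    maximal : ∀ p′ q′ → ComposedOfEdges ℝ decomposition y-axis (- ι (far true i)) p′ q′ →
              p′ ≤ ι (near false i) → ι n ≤ q′ → p′ ≈ ι (near false i) × q′ ≈ ι n
    maximal p′ q′ composed p′≤p q≤q′ = antisym p′≤p p≤p′ , antisym q′≤q q≤q′
      where
      open ComposedOfEdges composed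

      q′≤q : q′ ≤ ι n
      q′≤q with edges q′ (proj₁ p<q) ≤-refl
      ... | k , _ , (_ , q′≤hi) , _ = ≤-trans q′≤hi (ι-mono-≤ (far≤1+m false k))

      p≤p′ : ι (near false i) ≤ p′
      p≤p′ with edges p′ ≤-refl (proj₁ p<q)
      ... | k , c-edge , (lo≤p′ , _) , _ = ≤-trans (ι-mono-≤ (near-mono false
        (far-meets (ℕ.<⇒≢ far<n) (Sum.swap (Sum.map (≡.sym ∘ -ι-injective) (≡.sym ∘ -ι-injective) c-edge))))) lo≤p′

  leftOf⇒< : ∀ {i j} → LeftOf ℝ decomposition i j → i Fin.< j
  leftOf⇒< {i} {j} [ _ , _ , _ , _ , (hi≈c , _) , (lo≈c , _) ] =
    far≡near⇒< {false} {i} {j} (ι-injective (trans hi≈c (sym lo≈c)))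
  leftOf⇒< {i} {j} (Plus._∷_ {y = k} step rest) =
    Fin.<-trans {i = i} {k} {j} (leftOf⇒< {i} {k} [ step ]) (leftOf⇒< {k} {j} rest)

  above⇒< : ∀ {i j} → Above ℝ decomposition i j → i Fin.< j
  above⇒< {i} {j} [ _ , _ , _ , _ , (hi≈c , _) , (lo≈c , _) ] =
    far≡near⇒< {true} {i} {j} (-ι-injective (trans lo≈c (sym hi≈c)))
  above⇒< {i} {j} (Plus._∷_ {y = k} step rest) =
    Fin.<-trans {i = i} {k} {j} (above⇒< {i} {k} [ step ]) (above⇒< {k} {j} rest)

  rectangulation : Rectangulation ℝ n
  rectangulation = record
    { decomposition = decomposition
    ; labelling     = λ i j → mk⇔ (before i j)
        λ { (inj₁ above) → above⇒< {i} {j} above ; (inj₂ left) → leftOf⇒< {i} {j} left }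
    }
    where
    -- The colour of i alone decides: everything later than a row is below it, everything later than
    -- a column is to its right.
    before : ∀ i j → i Fin.< j → Below ℝ decomposition j i ⊎ RightOf ℝ decomposition j i
    before i j i<j with lookup X i in i≡c
    ... | true  = inj₁ (chain {true} {G = λ _ → Unit.⊤} (λ _ → Unit.tt)
                      (λ k≡c _ → commonSegment-y k≡c) i≡c Unit.tt i<j)
    ... | false = inj₂ (chain {false} {G = λ _ → Unit.⊤} (λ _ → Unit.tt)
                      (λ k≡c _ → commonSegment-x k≡c) i≡c Unit.tt i<j)

-- Up-sets and chains in the weak and strong posets.

module CornerPosets (ℝ : RealNumbers) {m : ℕ} (X : Vec Bool (suc m)) where
  open OrderedField ℝ
  open NaturalNumbersIn ℝ
  open Corner X
  open CornerRectangulation ℝ X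
  open Rectangle using (lo; hi)

  -- The first puts the indicator of X into the order cone. The second is stronger than
  -- connectedness: X and its complement are chains.
  Increasing Connecting : Rel (Fin n) 0ℓ → Set
  Increasing _≺_ = ∀ {i j} → i ≺ j → lookup X i ≡ true → lookup X j ≡ true
  Connecting _≺_ = ∀ {i j} → lookup X i ≡ lookup X j → i ≢ j → i ≺ j ⊎ j ≺ i

  increasing⁺ : ∀ {S : Rel (Fin n) 0ℓ} → Increasing S → Increasing (TransClosure S)
  increasing⁺ inc [ step ]              i∈X = inc step i∈X
  increasing⁺ inc (step Plus.∷ further) i∈X = increasing⁺ inc further (inc step i∈X)

  reverse⁺ : ∀ {S : Rel (Fin n) 0ℓ} {i j} → TransClosure (flip S) i j → TransClosure S j i
  reverse⁺ [ step ]              = [ step ]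
  reverse⁺ (step Plus.∷ further) = reverse⁺ further Plus.∷ʳ step

  -- Columns are linked from left to right, along the label order; rows are linked from bottom to
  -- top, against it, and therefore need the reversed chain.
  connecting⁺ : ∀ {S : Rel (Fin n) 0ℓ} →
    (∀ {i j} → lookup X i ≡ false → lookup X j ≡ false → far false i ≡ near false j → S i j) →
    (∀ {i j} → lookup X i ≡ true → lookup X j ≡ true → far true i ≡ near true j → S j i) →
    Connecting (TransClosure S)
  connecting⁺ {S} columns rows {i} {j} i≡j i≢j = compare
    where
    link : ∀ {i j} → lookup X i ≡ lookup X j → i Fin.< j → TransClosure S i j ⊎ TransClosure S j i
    link {i} {j} i≡j i<j with lookup X i in i≡c
    ... | false = inj₁ (chain {G = λ k → lookup X k ≡ false} id columns i≡c (≡.sym i≡j) i<j)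
    ... | true  = inj₂ (reverse⁺ (chain {S = flip S} {G = λ k → lookup X k ≡ true} id rows i≡c (≡.sym i≡j) i<j))

    compare : TransClosure S i j ⊎ TransClosure S j i
    compare with Fin.<-cmp i j
    ... | tri< i<j _ _ = link i≡j i<j
    ... | tri≈ _ eq _  = contradiction eq i≢j
    ... | tri> _ _ j<i = Sum.swap (link (≡.sym i≡j) j<i)

  private
    lo≤hi : ∀ k {p q} a → p ≈ lo (rect k) a → q ≈ hi (rect k) a → p ≤ q
    lo≤hi k a p≈ q≈ = ≤-resp₂ (sym p≈) (sym q≈) (proj₁ (Rectangle.lo<hi (rect k) a))

    level : ∀ {p q r} → p ≈ r → q ≈ r → p ≤ q
    level p≈ q≈ = ≤-reflexive (trans p≈ (sym q≈))

  arc-increasing : ∀ {p q} → Arc ℝ decomposition p q → ∀ a → p a ≤ q a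
  arc-increasing (k , inj₁ (p≈ , q≈)) = λ where
    x-axis → lo≤hi k x-axis (p≈ x-axis) (q≈ x-axis)
    y-axis → level (p≈ y-axis) (q≈ y-axis)
  arc-increasing (k , inj₂ (inj₁ (p≈ , q≈))) = λ where
    x-axis → lo≤hi k x-axis (p≈ x-axis) (q≈ x-axis)
    y-axis → level (p≈ y-axis) (q≈ y-axis)
  arc-increasing (k , inj₂ (inj₂ (inj₁ (p≈ , q≈)))) = λ where
    x-axis → level (p≈ x-axis) (q≈ x-axis)
    y-axis → lo≤hi k y-axis (p≈ y-axis) (q≈ y-axis)
  arc-increasing (k , inj₂ (inj₂ (inj₂ (p≈ , q≈)))) = λ where
    x-axis → level (p≈ x-axis) (q≈ x-axis)
    y-axis → lo≤hi k y-axis (p≈ y-axis) (q≈ y-axis)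

  far-other : ∀ {c i} → lookup X i ≢ c → far c i ≡ suc m
  far-other i≢c = far-whole (i≢c ∘ proj₁)

  -- If i is cut off first, then j starts beyond that cut and, being of the other colour, reaches
  -- the far side of the square. If j is cut off first, then i starts beyond the cut of j. The
  -- source tree uses this for a row i and a column j, the target tree with their roles exchanged.
  no-overtaking : ∀ {i j} → lookup X i ≢ lookup X j →
                  far (lookup X i) j ℕ.≤ far (lookup X i) i →
                  ¬ (near (lookup X j) i ℕ.≤ near (lookup X j) j)
  no-overtaking {i} {j} i≢j far≤ near≤ with Fin.<-cmp i j
  ... | tri≈ _ i≡j _ = i≢j (≡.cong (lookup X) i≡j)
  ... | tri< i<j _ _ = ℕ.<⇒≱ (near<1+m (lookup X i) j)
    (ℕ.≤-trans (ℕ.≤-reflexive (≡.sym (far-other (i≢j ∘ ≡.sym)))) (ℕ.≤-trans far≤ (far≤near ≡.refl i<j)))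
  ... | tri> _ _ j<i = ℕ.<⇒≱ (near<far (lookup X j) j) (ℕ.≤-trans (far≤near ≡.refl j<i) near≤)

  true≢false : ∀ {i j} → lookup X i ≡ true → lookup X j ≡ false → lookup X i ≢ lookup X j
  true≢false i≡true j≡false i≡j = case ≡.trans (≡.sym i≡true) (≡.trans i≡j j≡false) of λ ()

  increasing-unless : ∀ (S : Rel (Fin n) 0ℓ) →
    (∀ i j → S i j → lookup X i ≡ true → ¬ (lookup X j ≡ false)) → Increasing S
  increasing-unless S never {i} {j} s i∈X with lookup X j in j≡c
  ... | true  = ≡.refl
  ... | false = contradiction j≡c (never i j s i∈X)

  sourceTree-increasing : Increasing (SourceTree ℝ decomposition)
  sourceTree-increasing = increasing-unless (SourceTree ℝ decomposition) λ i j arc i≡true j≡false →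
    no-overtaking {i} {j} (true≢false i≡true j≡false)
      (≡.subst (λ c → far c j ℕ.≤ far c i) (≡.sym i≡true)
        (-ι-cancel-≤ (arc-increasing {lo (rect i)} {lo (rect j)} arc y-axis)))
      (≡.subst (λ c → near c i ℕ.≤ near c j) (≡.sym j≡false)
        (ι-cancel-≤ (arc-increasing {lo (rect i)} {lo (rect j)} arc x-axis)))

  targetTree-increasing : Increasing (TargetTree ℝ decomposition)
  targetTree-increasing = increasing-unless (TargetTree ℝ decomposition) λ i j arc i≡true j≡false →
    no-overtaking {j} {i} (true≢false i≡true j≡false ∘ ≡.sym)
      (≡.subst (λ c → far c i ℕ.≤ far c j) (≡.sym j≡false)
        (ι-cancel-≤ (arc-increasing {hi (rect i)} {hi (rect j)} arc x-axis)))
      (≡.subst (λ c → near c j ℕ.≤ near c i) (≡.sym i≡true)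
        (-ι-cancel-≤ (arc-increasing {hi (rect i)} {hi (rect j)} arc y-axis)))

  row-far : ∀ {i} → lookup X i ≡ true → far false i ≡ suc m
  row-far i≡true = far-other λ i≡false → case ≡.trans (≡.sym i≡true) i≡false of λ ()

  column-far : ∀ {i} → lookup X i ≡ false → far true i ≡ suc m
  column-far i≡false = far-other λ i≡true → case ≡.trans (≡.sym i≡true) i≡false of λ ()

  -- A row reaches the right side of the square, so nothing adjoins it on the right; a column
  -- reaches the bottom, so nothing adjoins it from below.
  adjacent-increasing : Increasing (Adjacent ℝ decomposition)
  adjacent-increasing = increasing-unless (Adjacent ℝ decomposition) λ where
    i j (x-axis , hi≈lo , _) i≡true _ → ℕ.<⇒≢ (near<1+m false j)
      (≡.trans (≡.sym (ι-injective hi≈lo)) (row-far i≡true))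
    i j (y-axis , hi≈lo , _) _ j≡false → ℕ.<⇒≢ (near<1+m true i)
      (≡.trans (-ι-injective hi≈lo) (column-far j≡false))

  special-increasing : Increasing (Special ℝ decomposition)
  special-increasing = increasing-unless (Special ℝ decomposition) λ where
    i j (x-axis , _ , (hi≤lo , _)) _ j≡false → ℕ.<⇒≱ (near<1+m true i)
      (≡.subst (ℕ._≤ near true i) (column-far j≡false) (-ι-cancel-≤ hi≤lo))
    i j (y-axis , _ , (hi≤lo , _)) i≡true _ → ℕ.<⇒≱ (near<1+m false j)
      (≡.subst (ℕ._≤ near false j) (row-far i≡true) (ι-cancel-≤ hi≤lo))

  weakPoset-increasing : Increasing (WeakPoset ℝ decomposition)
  weakPoset-increasing = increasing⁺ Sum.[ sourceTree-increasing , targetTree-increasing ]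

  strongPoset-increasing : Increasing (StrongPoset ℝ decomposition)
  strongPoset-increasing = increasing⁺ Sum.[ increasing⁺ adjacent-increasing , special-increasing ]

  weakPoset-connecting : Connecting (WeakPoset ℝ decomposition)
  weakPoset-connecting = connecting⁺
    -- Both columns stand on the bottom of the square, so the bottom side of i is an arc of the
    -- source tree.
    (λ {i} i≡false j≡false meet → inj₁ (i , inj₁ ((λ _ → refl) , λ where
      x-axis → reflexive (≡.cong ι (≡.sym meet))
      y-axis → reflexive (≡.cong (-_ ∘ ι) (≡.trans (column-far j≡false) (≡.sym (column-far i≡false)))))))
    -- Both rows end on the right of the square, so the right side of i is an arc of the target
    -- tree.
    (λ {i} i≡true j≡true meet → inj₂ (i , inj₂ (inj₂ (inj₂ ((λ where
      x-axis → reflexive (≡.cong ι (≡.trans (row-far j≡true) (≡.sym (row-far i≡true))))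
      y-axis → reflexive (≡.cong (-_ ∘ ι) (≡.sym meet))) , λ _ → refl)))))

  strongPoset-connecting : Connecting (StrongPoset ℝ decomposition)
  strongPoset-connecting = connecting⁺
    (λ {i} {j} i≡false j≡false meet → inj₁ [ x-axis , reflexive (≡.cong ι meet)
      , -ι-mono-< (≡.subst (near true j ℕ.<_) (≡.sym (column-far i≡false)) (near<1+m true j))
      , -ι-mono-< (≡.subst (near true i ℕ.<_) (≡.sym (column-far j≡false)) (near<1+m true i)) ])
    (λ {i} {j} i≡true j≡true meet → inj₁ [ y-axis , reflexive (≡.cong (-_ ∘ ι) (≡.sym meet))
      , ι-mono-< (≡.subst (near false j ℕ.<_) (≡.sym (row-far i≡true)) (near<1+m false j))
      , ι-mono-< (≡.subst (near false i ℕ.<_) (≡.sym (row-far j≡true)) (near<1+m false i)) ])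

-- Linear equations and affine dimension.

module LinearAlgebra (ℝ : RealNumbers) where
  open Vector using (_∷_; _++_; insertAt; removeAt)
  open OrderedField ℝ
  open Algebra.Properties.Semiring.Sum semiring public
    using (sum; sum-cong-≋; sum-remove; sum-replicate-zero; ∑-distrib-+; ∑-comm; *-distribˡ-sum; *-distribʳ-sum)
  open ≈-Reasoning

  private variable
    m n r : ℕ

  infix 8 _∙_
  _∙_ : Vector Carrier n → Vector Carrier n → Carrier
  _∙_ = ⟨_,_⟩ ℝ

  infixl 6 _⊕_
  _⊕_ : Vector Carrier n → Vector Carrier n → Vector Carrier n
  (v ⊕ w) i = v i + w i

  infixr 7 _⊙_
  _⊙_ : Carrier → Vector Carrier n → Vector Carrier n
  (c ⊙ v) i = c * v i

  combination : Vector Carrier m → (Fin m → Vector Carrier n) → Vector Carrier n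
  combination t p i = sum λ k → t k * p k i

  δ : Fin n → Vector Carrier n
  δ j i = if does (i Fin.≟ j) then 1# else 0#

  sum-≈0 : ∀ {f : Vector Carrier n} → (∀ i → f i ≈ 0#) → sum f ≈ 0#
  sum-≈0 {n} f≈0 = trans (sum-cong-≋ f≈0) (sum-replicate-zero n)

  sum-mono : ∀ {f g : Vector Carrier n} → (∀ i → f i ≤ g i) → sum f ≤ sum g
  sum-mono {zero}  f≤g = ≤-refl
  sum-mono {suc n} f≤g = +-mono-≤ (f≤g Fin.zero) (sum-mono (f≤g ∘ Fin.suc))

  sum-++ : ∀ m (f : Vector Carrier (m ℕ.+ n)) →
           sum f ≈ sum (λ k → f (k ↑ˡ n)) + sum (λ k → f (m ↑ʳ k))
  sum-++ zero    f = sym (+-identityˡ _)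
  sum-++ (suc m) f = trans (+-congˡ (sum-++ m (f ∘ Fin.suc))) (sym (+-assoc _ _ _))

  ∙-cong : ∀ {v w x y : Vector Carrier n} → (∀ i → v i ≈ w i) → (∀ i → x i ≈ y i) → v ∙ x ≈ w ∙ y
  ∙-cong v≈w x≈y = sum-cong-≋ λ i → *-cong (v≈w i) (x≈y i)

  ∙-comm : ∀ (v w : Vector Carrier n) → v ∙ w ≈ w ∙ v
  ∙-comm v w = sum-cong-≋ λ i → *-comm (v i) (w i)

  ∙-⊕ : ∀ (v w x : Vector Carrier n) → (v ⊕ w) ∙ x ≈ v ∙ x + w ∙ x
  ∙-⊕ v w x = trans (sum-cong-≋ λ i → distribʳ (x i) (v i) (w i)) (∑-distrib-+ (λ i → v i * x i) (λ i → w i * x i))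

  ∙-⊙ : ∀ c (v x : Vector Carrier n) → (c ⊙ v) ∙ x ≈ c * v ∙ x
  ∙-⊙ c v x = trans (sum-cong-≋ λ i → *-assoc c (v i) (x i)) (sym (*-distribˡ-sum c (λ i → v i * x i)))

  ∙-affine : ∀ (v : Vector Carrier n) c u x → (v ⊕ c ⊙ u) ∙ x ≈ v ∙ x + c * u ∙ x
  ∙-affine v c u x = trans (∙-⊕ v (c ⊙ u) x) (+-congˡ (∙-⊙ c u x))

  ∙-combination : ∀ (w : Vector Carrier n) (t : Vector Carrier m) p →
                  w ∙ combination t p ≈ sum (λ k → t k * w ∙ p k)
  ∙-combination w t p = begin
    sum (λ i → w i * sum (λ k → t k * p k i))     ≈⟨ sum-cong-≋ (λ i → *-distribˡ-sum (w i) (λ k → t k * p k i)) ⟩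
    sum (λ i → sum (λ k → w i * (t k * p k i)))   ≈⟨ ∑-comm (λ i k → w i * (t k * p k i)) ⟩
    sum (λ k → sum (λ i → w i * (t k * p k i)))   ≈⟨ sum-cong-≋ (λ k → sum-cong-≋ (λ i → swap (w i) (t k) (p k i))) ⟩
    sum (λ k → sum (λ i → t k * (w i * p k i)))   ≈⟨ sum-cong-≋ (λ k → *-distribˡ-sum (t k) (λ i → w i * p k i)) ⟨
    sum (λ k → t k * w ∙ p k)                     ∎
    where
    swap : ∀ x y z → x * (y * z) ≈ y * (x * z)
    swap = solve 3 (λ x y z → x :* (y :* z) := y :* (x :* z)) refl

  δ-∙ : ∀ j (x : Vector Carrier n) → δ j ∙ x ≈ x j
  δ-∙ Fin.zero    x = begin
    1# * x Fin.zero + sum (λ i → 0# * x (Fin.suc i))   ≈⟨ +-cong (*-identityˡ _)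
                                                            (sum-≈0 {f = λ i → 0# * x (Fin.suc i)} λ i → zeroˡ _) ⟩
    x Fin.zero + 0#                                    ≈⟨ +-identityʳ _ ⟩
    x Fin.zero                                         ∎
  δ-∙ (Fin.suc j) x = begin
    0# * x Fin.zero + sum (λ i → δ (Fin.suc j) (Fin.suc i) * x (Fin.suc i))   ≈⟨ +-cong (zeroˡ _) (δ-∙ j (x ∘ Fin.suc)) ⟩
    0# + x (Fin.suc j)                                                       ≈⟨ +-identityˡ _ ⟩
    x (Fin.suc j)                                                            ∎

  0∙ : ∀ {v : Vector Carrier n} → (∀ i → v i ≈ 0#) → ∀ x → v ∙ x ≈ 0#
  0∙ v≈0 x = sum-≈0 λ i → trans (*-congʳ (v≈0 i)) (zeroˡ (x i))

  -- Gaussian elimination: a vanishing first row is dropped, and otherwise a pivot in it removes one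
  -- equation together with one unknown.
  kernel : ∀ {m n} → m ℕ.< n → (A : Fin m → Vector Carrier n) →
           ∃[ t ] ((∃[ j ] ¬ (t j ≈ 0#)) × (∀ i → A i ∙ t ≈ 0#))
  kernel {zero}  (s≤s z≤n)   A = (λ _ → 1#) , (Fin.zero , 0≉1 ∘ sym) , λ ()
  kernel {suc m} (s≤s {n = n} m<n) A with Fin.any? (λ j → ¬? (A Fin.zero j ≟ 0#))
  ... | no  row≈0 = let t , t≉0 , A∙t≈0 = kernel (ℕ.m<n⇒m<1+n m<n) (A ∘ Fin.suc) in
    t , t≉0 , λ { Fin.zero    → 0∙ (λ j → case A Fin.zero j ≟ 0# of λ
                                   { (yes eq) → eq ; (no neq) → contradiction (j , neq) row≈0 }) t
                ; (Fin.suc i) → A∙t≈0 i }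
  ... | yes (j , a≉0) with inverse (A Fin.zero j) a≉0
  ...   | b , ab≈1 with kernel m<n (λ i k →
    A (Fin.suc i) (punchIn j k) + (- (A (Fin.suc i) j * b)) * A Fin.zero (punchIn j k))
  ...     | t′ , (k , t′k≉0) , solves =
    t , (punchIn j k , nonzero) , λ { Fin.zero → pivot-row ; (Fin.suc i) → other-row i }
    where
    rest : Vector Carrier (suc n) → Carrier
    rest a = sum λ k → a (punchIn j k) * t′ k

    t : Vector Carrier (suc n)
    -- The new entry is the first equation solved for the pivot unknown.
    t = insertAt t′ j (- (b * rest (A Fin.zero)))

    nonzero : ¬ (t (punchIn j k) ≈ 0#)
    nonzero eq = t′k≉0 (trans (reflexive (≡.sym (Vectorₚ.insertAt-punchIn t′ j _ k))) eq)

    expand : ∀ a → a ∙ t ≈ a j * - (b * rest (A Fin.zero)) + rest a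
    expand a = begin
      a ∙ t
        ≈⟨ sum-remove {i = j} (λ i → a i * t i) ⟩
      a j * t j + sum (removeAt (λ i → a i * t i) j)
        ≈⟨ +-cong (*-congˡ (reflexive (Vectorₚ.insertAt-lookup t′ j _)))
                  (sum-cong-≋ λ k → *-congˡ (reflexive (Vectorₚ.insertAt-punchIn t′ j _ k))) ⟩
      a j * - (b * rest (A Fin.zero)) + rest a ∎

    pivot-row : A Fin.zero ∙ t ≈ 0#
    pivot-row = begin
      A Fin.zero ∙ t                                ≈⟨ expand (A Fin.zero) ⟩
      a * - (b * s) + s                             ≈⟨ solve 3 (λ a b s →
                                                         a :* (:- (b :* s)) :+ s := (:- (a :* b)) :* s :+ s) refl a b s ⟩
      - (a * b) * s + s                             ≈⟨ +-congʳ (*-congʳ (-‿cong ab≈1)) ⟩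
      - 1# * s + s                                  ≈⟨ solve 1 (λ s → (:- con (+ 1)) :* s :+ s := con (+ 0)) refl s ⟩
      0#                                            ∎
      where
      a = A Fin.zero j
      s = rest (A Fin.zero)

    other-row : ∀ i → A (Fin.suc i) ∙ t ≈ 0#
    other-row i = begin
      A (Fin.suc i) ∙ t
        ≈⟨ expand (A (Fin.suc i)) ⟩
      a * - (b * rest (A Fin.zero)) + rest (A (Fin.suc i))
        ≈⟨ solve 4 (λ a b s u → a :* (:- (b :* s)) :+ u := u :+ (:- (a :* b)) :* s) refl a b _ _ ⟩
      rest (A (Fin.suc i)) + - (a * b) * rest (A Fin.zero)
        ≈⟨ +-congˡ (∙-⊙ (- (a * b)) (A Fin.zero ∘ punchIn j) t′) ⟨
      rest (A (Fin.suc i)) + (- (a * b) ⊙ (A Fin.zero ∘ punchIn j)) ∙ t′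
        ≈⟨ ∙-⊕ (A (Fin.suc i) ∘ punchIn j) _ t′ ⟨
      ((A (Fin.suc i) ∘ punchIn j) ⊕ (- (a * b) ⊙ (A Fin.zero ∘ punchIn j))) ∙ t′
        ≈⟨ solves i ⟩
      0# ∎
      where
      a = A (Fin.suc i) j

  Independent : (Fin m → Vector Carrier n) → Set
  Independent = AffinelyIndependent ℝ

  -- Pairing a dependence with w leaves only the coefficient of y, multiplied by the nonzero w ∙ y -
  -- c.
  extend-independent : ∀ {p : Fin m → Vector Carrier n} {y} (w : Vector Carrier n) c →
    Independent p → (∀ k → w ∙ p k ≈ c) → ¬ (w ∙ y ≈ c) → Independent (y ∷ p)
  extend-independent {p = p} {y} w c indep const y≉c t Σt≈0 Σtp≈0 = λ
    { Fin.zero → t₀≈0 ; (Fin.suc k) → indep t′ Σt′≈0 Σt′p≈0 k }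
    where
    t₀ = t Fin.zero
    t′ = t ∘ Fin.suc

    t₀≈0 : t₀ ≈ 0#
    t₀≈0 = *-cancel-0 (begin
      (w ∙ y - c) * t₀
        ≈⟨ solve 4 (λ a c t s → (a :- c) :* t := (t :* a :+ s :* c) :- (t :+ s) :* c)
             refl (w ∙ y) c t₀ (sum t′) ⟩
      (t₀ * w ∙ y + sum t′ * c) - sum t * c
        ≈⟨ +-cong (+-congˡ (*-distribʳ-sum c t′)) (-‿cong (*-congʳ Σt≈0)) ⟩
      (t₀ * w ∙ y + sum (λ k → t′ k * c)) - 0# * c
        ≈⟨ +-congʳ (+-congˡ (sum-cong-≋ λ k → *-congˡ (const k))) ⟨
      sum (λ k → t k * w ∙ (y ∷ p) k) - 0# * c
        ≈⟨ +-congʳ (∙-combination w t (y ∷ p)) ⟨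
      w ∙ combination t (y ∷ p) - 0# * c
        ≈⟨ +-congʳ (trans (∙-comm w _) (0∙ Σtp≈0 w)) ⟩
      0# - 0# * c
        ≈⟨ solve 1 (λ c → con (+ 0) :- con (+ 0) :* c := con (+ 0)) refl c ⟩
      0# ∎) (y≉c ∘ x-y≈0⇒x≈y)

    drop₀ : ∀ {x s} → x ≈ 0# → x + s ≈ 0# → s ≈ 0#
    drop₀ {x} {s} x≈0 x+s≈0 = trans (sym (trans (+-congʳ x≈0) (+-identityˡ s))) x+s≈0

    Σt′≈0 : sum t′ ≈ 0#
    Σt′≈0 = drop₀ t₀≈0 Σt≈0

    Σt′p≈0 : ∀ i → combination t′ p i ≈ 0#
    Σt′p≈0 i = drop₀ (trans (*-congʳ t₀≈0) (zeroˡ _)) (Σtp≈0 i)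

  singleton-independent : (x : Vector Carrier n) → Independent {1} (λ _ → x)
  singleton-independent x t Σt≈0 _ Fin.zero = trans (sym (+-identityʳ _)) Σt≈0

  tail-independent : ∀ {p : Fin (suc m) → Vector Carrier n} → Independent p → Independent (p ∘ Fin.suc)
  tail-independent indep t Σt≈0 Σtp≈0 k = indep (0# ∷ t)
    (trans (+-identityˡ _) Σt≈0) (λ i → trans (+-congʳ (zeroˡ _)) (trans (+-identityˡ _) (Σtp≈0 i))) (Fin.suc k)

  IndependentIn : Pred (Vector Carrier n) 0ℓ → ℕ → Set
  IndependentIn {n} S k = Σ[ p ∈ (Fin k → Vector Carrier n) ] ((∀ j → p j ∈ S) × Independent p)

  shrink : ∀ {S : Pred (Vector Carrier n) 0ℓ} {k l} → k ℕ.≤′ l → IndependentIn S l → IndependentIn S k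
  shrink ℕ.≤′-refl       family              = family
  shrink {S = S} (ℕ.≤′-step k≤l) (p , p∈S , indep) =
    shrink {S = S} k≤l (p ∘ Fin.suc , p∈S ∘ Fin.suc , tail-independent {p = p} indep)

  dimension-unique : ∀ {S : Pred (Vector Carrier n) 0ℓ} {d e} →
                     HasDimension ℝ S d → HasDimension ℝ S e → d ≡ e
  dimension-unique {S = S} {d} {e} (at-least-d , at-most-d) (at-least-e , at-most-e) with ℕ.<-cmp d e
  ... | tri≈ _ d≡e _ = d≡e
  ... | tri< d<e _ _ = let p , p∈S , indep = shrink {S = S} (ℕ.≤⇒≤′ (s≤s d<e)) at-least-e in
    contradiction indep (at-most-d p p∈S)
  ... | tri> _ _ e<d = let p , p∈S , indep = shrink {S = S} (ℕ.≤⇒≤′ (s≤s e<d)) at-least-d in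
    contradiction indep (at-most-e p p∈S)

  -- While d + r < n, some nonzero w is orthogonal to all U a and to the d differences of the points
  -- found so far, so it is constant on these. Since w takes two values on S, one of them differs
  -- from that constant and supplies the next point.
  dimension-≥ : ∀ {S : Pred (Vector Carrier n) 0ℓ} → ∃ S → (U : Fin r → Vector Carrier n) →
    (∀ w → (∀ a → U a ∙ w ≈ 0#) → (∃[ i ] ¬ (w i ≈ 0#)) →
       ∃[ y ] ∃[ z ] (y ∈ S × z ∈ S × ¬ (w ∙ y ≈ w ∙ z))) →
    ∀ d → d ℕ.+ r ℕ.≤ n → IndependentIn S (suc d)
  dimension-≥ (x , x∈S) U moves zero    _    = (λ _ → x) , (λ _ → x∈S) , singleton-independent x
  dimension-≥ {n} {r} {S} inhabited U moves (suc d) d+r<n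
    with dimension-≥ inhabited U moves d (ℕ.<⇒≤ d+r<n)
  ... | p , p∈S , indep with kernel d+r<n ((λ k → p (Fin.suc k) ⊕ - 1# ⊙ p Fin.zero) ++ U)
  ...   | w , w≉0 , solves = extend
    where
    p₀ = p Fin.zero

    U∙w≈0 : ∀ a → U a ∙ w ≈ 0#
    U∙w≈0 a = trans (reflexive (≡.cong (_∙ w) (≡.sym (Vectorₚ.lookup-++ʳ {m = d} _ U a)))) (solves (d ↑ʳ a))

    constant : ∀ k → w ∙ p k ≈ w ∙ p₀
    constant Fin.zero    = refl
    constant (Fin.suc k) = x-y≈0⇒x≈y (begin
      w ∙ p (Fin.suc k) - w ∙ p₀               ≈⟨ +-cong (∙-comm w _) (-‿cong (∙-comm w p₀)) ⟩
      p (Fin.suc k) ∙ w - p₀ ∙ w               ≈⟨ +-congˡ (solve 1 (λ x → :- x := (:- con (+ 1)) :* x) refl (p₀ ∙ w)) ⟩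
      p (Fin.suc k) ∙ w + - 1# * p₀ ∙ w        ≈⟨ +-congˡ (∙-⊙ (- 1#) p₀ w) ⟨
      p (Fin.suc k) ∙ w + (- 1# ⊙ p₀) ∙ w      ≈⟨ ∙-⊕ (p (Fin.suc k)) (- 1# ⊙ p₀) w ⟨
      (p (Fin.suc k) ⊕ - 1# ⊙ p₀) ∙ w          ≡⟨ ≡.cong (_∙ w)
                                                     (Vectorₚ.lookup-++ˡ (λ k → p (Fin.suc k) ⊕ - 1# ⊙ p₀) U k) ⟨
      _                                        ≈⟨ solves (k ↑ˡ r) ⟩
      0#                                       ∎)

    add : ∀ y → y ∈ S → ¬ (w ∙ y ≈ w ∙ p₀) → IndependentIn S (suc (suc d))
    add y y∈S y≉p₀ = y ∷ p , (λ { Fin.zero → y∈S ; (Fin.suc k) → p∈S k })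
                   , extend-independent w (w ∙ p₀) indep constant y≉p₀

    extend : IndependentIn S (suc (suc d))
    extend with moves w U∙w≈0 w≉0
    ... | y , z , y∈S , z∈S , y≉z with w ∙ y ≟ w ∙ p₀
    ...   | no  y≉p₀ = add y y∈S y≉p₀
    ...   | yes y≈p₀ = add z z∈S λ z≈p₀ → y≉z (trans y≈p₀ (sym z≈p₀))

  -- The unknowns are the coefficients t of the points together with one s a for
  -- each U a: pairing a solution of Σ t = 0, Σ t p + Σ s U = 0 with W a gives
  -- s a = 0, so t is an affine dependence.
  dimension-≤ : ∀ {S : Pred (Vector Carrier n) 0ℓ} (U W : Fin r → Vector Carrier n) →
    (∀ a b → W a ∙ U b ≈ δ a b) →
    (∀ a → ∃[ c ] (∀ x → x ∈ S → W a ∙ x ≈ c)) →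
    ∀ {k} → suc n ℕ.< k ℕ.+ r → ¬ IndependentIn S k
  dimension-≤ {n} {r} {S} U W dual constant {k} n<k+r (p , p∈S , indep)
    -- One equation for the sum of the t and n for the coordinates, in k + r unknowns.
    with kernel {suc n} n<k+r ((λ x → (Vector.replicate k 1# ++ Vector.replicate r 0#) x) ∷ λ i x → (p ++ U) x i)
  ... | τ , (x , τx≉0) , solves = τx≉0 (τ≈0 x)
    where
    t : Vector Carrier k
    t j = τ (j ↑ˡ r)
    s : Vector Carrier r
    s a = τ (k ↑ʳ a)

    split : ∀ (f : Vector Carrier k) (g : Vector Carrier r) →
            sum (λ x → τ x * (f ++ g) x) ≈ sum (λ j → t j * f j) + sum (λ a → s a * g a)
    split f g = trans (sum-++ k _) (+-cong
      (sum-cong-≋ λ j → *-congˡ (reflexive (Vectorₚ.lookup-++ˡ f g j)))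
      (sum-cong-≋ λ a → *-congˡ (reflexive (Vectorₚ.lookup-++ʳ f g a))))

    Σt≈0 : sum t ≈ 0#
    Σt≈0 = begin
      sum t                                                         ≈⟨ sum-cong-≋ (λ j → *-identityʳ (t j)) ⟨
      sum (λ j → t j * 1#)                                          ≈⟨ +-identityʳ _ ⟨
      sum (λ j → t j * 1#) + 0#                                     ≈⟨ +-congˡ (sum-≈0 λ a → zeroʳ (s a)) ⟨
      sum (λ j → t j * 1#) + sum (λ a → s a * 0#)                   ≈⟨ split _ _ ⟨
      sum (λ x → τ x * (Vector.replicate k 1# ++ Vector.replicate r 0#) x) ≈⟨ ∙-comm τ _ ⟩
      _                                                             ≈⟨ solves Fin.zero ⟩
      0#                                                            ∎

    vanishes : ∀ i → combination τ (p ++ U) i ≈ 0#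
    vanishes i = trans (∙-comm τ _) (solves (Fin.suc i))

    ++-map : ∀ (w : Vector Carrier n) x → w ∙ (p ++ U) x ≈ ((λ j → w ∙ p j) ++ (λ a → w ∙ U a)) x
    ++-map w x with splitAt k x
    ... | inj₁ j = refl
    ... | inj₂ a = refl

    s≈0 : ∀ a → s a ≈ 0#
    s≈0 a = let c , W∙≈c = constant a in begin
      s a                                                           ≈⟨ δ-∙ a s ⟨
      δ a ∙ s                                                       ≈⟨ ∙-comm (δ a) s ⟩
      sum (λ b → s b * δ a b)                                       ≈⟨ sum-cong-≋ (λ b → *-congˡ (dual a b)) ⟨
      sum (λ b → s b * W a ∙ U b)                                   ≈⟨ +-identityˡ _ ⟨
      0# + sum (λ b → s b * W a ∙ U b)                              ≈⟨ +-congʳ (trans (*-congʳ Σt≈0) (zeroˡ c)) ⟨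
      sum t * c + sum (λ b → s b * W a ∙ U b)                       ≈⟨ +-congʳ (*-distribʳ-sum c t) ⟩
      sum (λ j → t j * c) + sum (λ b → s b * W a ∙ U b)             ≈⟨ +-congʳ (sum-cong-≋ λ j → *-congˡ (W∙≈c (p j) (p∈S j))) ⟨
      sum (λ j → t j * W a ∙ p j) + sum (λ b → s b * W a ∙ U b)     ≈⟨ split _ _ ⟨
      sum (λ x → τ x * ((λ j → W a ∙ p j) ++ (λ b → W a ∙ U b)) x)  ≈⟨ sum-cong-≋ (λ x → *-congˡ (++-map (W a) x)) ⟨
      sum (λ x → τ x * W a ∙ (p ++ U) x)                            ≈⟨ ∙-combination (W a) τ (p ++ U) ⟨
      W a ∙ combination τ (p ++ U)                                  ≈⟨ trans (∙-comm (W a) _) (0∙ vanishes (W a)) ⟩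
      0#                                                            ∎

    Σtp≈0 : ∀ i → combination t p i ≈ 0#
    Σtp≈0 i = begin
      combination t p i                                                 ≈⟨ +-identityʳ _ ⟨
      combination t p i + 0#                                            ≈⟨ +-congˡ (sum-≈0 λ a →
                                                                             trans (*-congʳ (s≈0 a)) (zeroˡ (U a i))) ⟨
      combination t p i + combination s U i                             ≈⟨ split (λ j → p j i) (λ a → U a i) ⟨
      sum (λ x → τ x * ((λ j → p j i) ++ (λ a → U a i)) x)              ≈⟨ sum-cong-≋ (λ x → *-congˡ (coordinate x)) ⟩
      combination τ (p ++ U) i                                          ≈⟨ vanishes i ⟩
      0#                                                                ∎
      where
      coordinate : ∀ x → ((λ j → p j i) ++ (λ a → U a i)) x ≈ (p ++ U) x i
      coordinate x with splitAt k x
      ... | inj₁ j = refl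
      ... | inj₂ a = refl

    τ≈0 : ∀ x → τ x ≈ 0#
    τ≈0 x with splitAt k x in eq
    ... | inj₁ j = trans (reflexive (≡.cong τ (≡.sym (Fin.splitAt⁻¹-↑ˡ eq)))) (indep t Σt≈0 Σtp≈0 j)
    ... | inj₂ a = trans (reflexive (≡.cong τ (≡.sym (Fin.splitAt⁻¹-↑ʳ {k} eq)))) (s≈0 a)

-- Lexicographic comparison and small perturbations.

module Lexicographic (ℝ : RealNumbers) where
  open OrderedField ℝ

  -- A lexicographic order made quantitative: the affine functions a + ε b and a′ + ε b′ are
  -- compared at ε = 0 and ε = δ, hence everywhere between.
  Dominates : Carrier → (a b a′ b′ : Carrier) → Set
  Dominates δ a b a′ b′ = a ≤ a′ × a + δ * b ≤ a′ + δ * b′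

  -- Convex interpolation between the parameters 0 and δ.
  dominates-≤ : ∀ {δ ε a b a′ b′} → 0# < δ → 0# ≤ ε → ε ≤ δ →
                Dominates δ a b a′ b′ → Dominates ε a b a′ b′
  dominates-≤ {δ} {ε} {a} {b} {a′} {b′} 0<δ 0≤ε ε≤δ (a≤a′ , at-δ) =
    a≤a′ , *-cancelˡ-≤ 0<δ (0≤-⇒≤ (≤-resp₂ (+-identityˡ 0#)
    (solve 6 (λ δ ε a b a′ b′ →
       (δ :- ε) :* (a′ :- a) :+ ε :* ((a′ :+ δ :* b′) :- (a :+ δ :* b))
       := δ :* (a′ :+ ε :* b′) :- δ :* (a :+ ε :* b)) refl δ ε a b a′ b′)
    (+-mono-≤ (*-nonNegative (≤⇒0≤- ε≤δ) (≤⇒0≤- a≤a′)) (*-nonNegative 0≤ε (≤⇒0≤- at-δ)))))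

  dominates-trans : ∀ {δ a b a′ b′ a″ b″} → Dominates δ a b a′ b′ → Dominates δ a′ b′ a″ b″ → Dominates δ a b a″ b″
  dominates-trans (le₁ , le₁′) (le₂ , le₂′) = ≤-trans le₁ le₂ , ≤-trans le₁′ le₂′

  min-positive : ∀ {δ ε} → 0# < δ → 0# < ε → ∃[ ζ ] (0# < ζ × ζ ≤ δ × ζ ≤ ε)
  min-positive {δ} {ε} 0<δ 0<ε with total δ ε
  ... | inj₁ δ≤ε = δ , 0<δ , ≤-refl , δ≤ε
  ... | inj₂ ε≤δ = ε , 0<ε , ε≤δ , ≤-refl

  dominates-1 : ∀ {a b a′ b′} → a ≤ a′ → b ≤ b′ → Dominates 1# a b a′ b′
  dominates-1 a≤a′ b≤b′ = a≤a′ , +-mono-≤ a≤a′ (*-monoˡ-≤ 0≤1 b≤b′)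

  dominates-strict : ∀ {a b a′ b′} → a < a′ → ∃[ δ ] (0# < δ × Dominates δ a b a′ b′)
  dominates-strict {a} {b} {a′} {b′} (a≤a′ , a≉a′) with b ≤? b′
  ... | yes b≤b′ = 1# , 0<1 , dominates-1 a≤a′ b≤b′
  ... | no  b≰b′ with ≰⇒> b≰b′
  ...   | b′≤b , b′≉b with positive-inverse (≤⇒0≤- b′≤b , λ eq → b′≉b (sym (x-y≈0⇒x≈y (sym eq))))
  -- Take δ = (a′ - a) / (b - b′), where the two affine functions meet.
  ...     | e , (0≤e , 0≉e) , [b-b′]e≈1 = (a′ - a) * e
          , (*-nonNegative (≤⇒0≤- a≤a′) 0≤e
            , λ eq → 0≉e (sym (*-cancel-0 (sym eq) λ eq′ → a≉a′ (sym (x-y≈0⇒x≈y eq′)))))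
          , a≤a′ , ≤-reflexive (begin
            a + (a′ - a) * e * b
              ≈⟨ solve 5 (λ a b a′ b′ e → a :+ (a′ :- a) :* e :* b :=
                   (a :+ (a′ :- a) :* ((b :- b′) :* e)) :+ (a′ :- a) :* e :* b′) refl a b a′ b′ e ⟩
            (a + (a′ - a) * ((b - b′) * e)) + (a′ - a) * e * b′
              ≈⟨ +-congʳ (+-congˡ (*-congˡ [b-b′]e≈1)) ⟩
            (a + (a′ - a) * 1#) + (a′ - a) * e * b′
              ≈⟨ +-congʳ (solve 2 (λ a a′ → a :+ (a′ :- a) :* con (+ 1) := a′) refl a a′) ⟩
            a′ + (a′ - a) * e * b′ ∎)
          where open ≈-Reasoning

  dominates-total : ∀ a b a′ b′ → ∃[ δ ] (0# < δ × (Dominates δ a b a′ b′ ⊎ Dominates δ a′ b′ a b))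
  dominates-total a b a′ b′ with a ≤? a′ | a′ ≤? a
  ... | no a≰a′ | _ = let δ , 0<δ , dom = dominates-strict (≰⇒> a≰a′) in δ , 0<δ , inj₂ dom
  ... | yes _ | no a′≰a = let δ , 0<δ , dom = dominates-strict (≰⇒> a′≰a) in δ , 0<δ , inj₁ dom
  ... | yes a≤a′ | yes a′≤a with total b b′
  ...   | inj₁ b≤b′ = 1# , 0<1 , inj₁ (dominates-1 a≤a′ b≤b′)
  ...   | inj₂ b′≤b = 1# , 0<1 , inj₂ (dominates-1 a′≤a b′≤b)

  -- Each comparison has its own threshold, and the least of finitely many positive thresholds
  -- serves all of them.
  lexicographic-max : ∀ {s} (a b : Fin (suc s) → Carrier) →
    ∃[ k ] ∃[ δ ] (0# < δ × (∀ j → Dominates δ (a j) (b j) (a k) (b k)))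
  lexicographic-max {zero}  a b = Fin.zero , 1# , 0<1 , λ { Fin.zero → ≤-refl , ≤-refl }
  lexicographic-max {suc s} a b with lexicographic-max (a ∘ Fin.suc) (b ∘ Fin.suc)
  ... | k , δ , 0<δ , dom with dominates-total (a Fin.zero) (b Fin.zero) (a (Fin.suc k)) (b (Fin.suc k))
  ...   | ε , 0<ε , compare with min-positive 0<δ 0<ε | compare
  ...     | ζ , 0<ζ , ζ≤δ , ζ≤ε | inj₁ below = Fin.suc k , ζ , 0<ζ , λ
    { Fin.zero    → dominates-≤ 0<ε (proj₁ 0<ζ) ζ≤ε below
    ; (Fin.suc j) → dominates-≤ 0<δ (proj₁ 0<ζ) ζ≤δ (dom j) }
  ...     | ζ , 0<ζ , ζ≤δ , ζ≤ε | inj₂ above = Fin.zero , ζ , 0<ζ , λ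
    { Fin.zero    → ≤-refl , ≤-refl
    ; (Fin.suc j) → dominates-trans (dominates-≤ 0<δ (proj₁ 0<ζ) ζ≤δ (dom j))
                                      (dominates-≤ 0<ε (proj₁ 0<ζ) ζ≤ε above) }

  finite-min : ∀ {s} (a : Fin (suc s) → Carrier) → ∃[ k ] (∀ j → a k ≤ a j)
  finite-min a = let k , _ , _ , dom = lexicographic-max (-_ ∘ a) (-_ ∘ a) in
    k , λ j → -‿anti-≤⁻¹ (proj₁ (dom j))

  finite-gap : ∀ {s} (a : Fin s → Carrier) → (∀ i → 0# ≤ a i) →
               ∃[ ε ] (0# < ε × (∀ i → ¬ (a i ≈ 0#) → ε ≤ a i))
  finite-gap {zero}  a 0≤a = 1# , 0<1 , λ ()
  finite-gap {suc s} a 0≤a with finite-gap (a ∘ Fin.suc) (0≤a ∘ Fin.suc) | a Fin.zero ≟ 0#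
  ... | ε , 0<ε , gap | yes a₀≈0 = ε , 0<ε , λ { Fin.zero a₀≉0 → contradiction a₀≈0 a₀≉0 ; (Fin.suc i) → gap i }
  ... | ε , 0<ε , gap | no  a₀≉0 with min-positive 0<ε (0≤a Fin.zero , a₀≉0 ∘ sym)
  ...   | ζ , 0<ζ , ζ≤ε , ζ≤a₀ = ζ , 0<ζ , λ { Fin.zero _ → ζ≤a₀ ; (Fin.suc i) aᵢ≉0 → ≤-trans ζ≤ε (gap i aᵢ≉0) }

  slope-unique : ∀ {δ a b a′ b′} → ¬ (δ ≈ 0#) → a ≈ a′ → a + δ * b ≈ a′ + δ * b′ → b ≈ b′
  slope-unique {δ} {a} {b} {a′} {b′} δ≉0 a≈a′ eq = x-y≈0⇒x≈y (*-cancel-0 (begin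
    δ * (b - b′)
      ≈⟨ solve 5 (λ δ a b c d → δ :* (b :- d) := ((a :+ δ :* b) :- (c :+ δ :* d)) :- (a :- c))
           refl δ a b a′ b′ ⟩
    ((a + δ * b) - (a′ + δ * b′)) - (a - a′)
      ≈⟨ +-cong (+-congʳ eq) (-‿cong (+-congʳ a≈a′)) ⟩
    ((a′ + δ * b′) - (a′ + δ * b′)) - (a′ - a′)
      ≈⟨ solve 2 (λ a b → (a :- a) :- (b :- b) := con (+ 0)) refl (a′ + δ * b′) a′ ⟩
    0# ∎) δ≉0)
    where open ≈-Reasoning

  squeezeˡ : ∀ a b c d → a + b ≤ c + d → d ≤ b → a ≤ c
  squeezeˡ a b c d a+b≤c+d d≤b = +-cancelʳ-≤ b (≤-trans a+b≤c+d (+-mono-≤ ≤-refl d≤b))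

  squeezeʳ : ∀ a b c d → a + b ≤ c + d → c ≤ a → b ≤ d
  squeezeʳ a b c d a+b≤c+d = squeezeˡ b a d c (≤-resp₂ (+-comm a b) (+-comm c d) a+b≤c+d)

  slope-≤ : ∀ {δ a b a′ b′} → 0# < δ → a ≈ a′ → a + δ * b ≤ a′ + δ * b′ → b ≤ b′
  slope-≤ {δ} {a} {b} {a′} {b′} 0<δ a≈a′ le =
    *-cancelˡ-≤ 0<δ (squeezeʳ a (δ * b) a′ (δ * b′) le (≤-reflexive (sym a≈a′)))

  -1*x≈-x : ∀ a → - 1# * a ≈ - a
  -1*x≈-x = solve 1 (λ a → (:- con (+ 1)) :* a := :- a) refl

-- Faces as sets of maximizers.

module PolytopeFaces (ℝ : RealNumbers) {n : ℕ} (P : Polytope ℝ n) where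
  open OrderedField ℝ
  open LinearAlgebra ℝ
  open Lexicographic ℝ
  open Polytope P

  hull : Pred (Vector Carrier n) 0ℓ
  hull = Hull ℝ P

  Max : Vector Carrier n → Pred (Vector Carrier n) 0ℓ
  Max = Maximizers ℝ P

  point∈hull : ∀ k → points k ∈ hull
  point∈hull k = δ k , nonneg , trans (sym sumδ) (δ-∙ k (λ _ → 1#)) , λ i → sym (δ-∙ k (λ j → points j i))
    where
    nonneg : ∀ j → 0# ≤ δ k j
    nonneg j with does (j Fin.≟ k)
    ... | true  = 0≤1
    ... | false = ≤-refl

    sumδ : δ k ∙ (λ _ → 1#) ≈ sum (δ k)
    sumδ = sum-cong-≋ λ j → *-identityʳ (δ k j)

  hull-bound : ∀ {v M} → (∀ k → v ∙ points k ≤ M) → ∀ {x} → x ∈ hull → v ∙ x ≤ M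
  hull-bound {v} {M} bound {x} (t , 0≤t , Σt≈1 , x≈) = begin
    v ∙ x                               ≈⟨ ∙-cong {v = v} (λ _ → refl) x≈ ⟩
    v ∙ combination t points            ≈⟨ ∙-combination v t points ⟩
    sum (λ k → t k * v ∙ points k)      ≤⟨ sum-mono (λ k → *-monoˡ-≤ (0≤t k) (bound k)) ⟩
    sum (λ k → t k * M)                 ≈⟨ *-distribʳ-sum M t ⟨
    sum t * M                           ≈⟨ *-congʳ Σt≈1 ⟩
    1# * M                              ≈⟨ *-identityˡ M ⟩
    M                                   ∎
    where open ≤-Reasoning

  -- The point is lexicographically maximal for v, then u. This replaces arguments with relative
  -- interiors throughout.
  max-perturbed : ∀ v u → ∃[ δ ] ∃[ y ] (0# < δ × y ∈ Max v × y ∈ Max (v ⊕ δ ⊙ u))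
  max-perturbed v u with lexicographic-max (λ k → v ∙ points k) (λ k → u ∙ points k)
  ... | k , δ , 0<δ , dom = δ , points k , 0<δ
    , (point∈hull k , λ y → hull-bound (proj₁ ∘ dom))
    , (point∈hull k , λ y → hull-bound λ j → ≤-resp₂ (sym (expand j)) (sym (expand k)) (proj₂ (dom j)))
    where
    expand : ∀ j → (v ⊕ δ ⊙ u) ∙ points j ≈ v ∙ points j + δ * u ∙ points j
    expand j = trans (∙-⊕ v (δ ⊙ u) (points j)) (+-congˡ (∙-⊙ δ u (points j)))

  max-nonempty : ∀ v → ∃ (Max v)
  max-nonempty v = let _ , y , _ , y∈ , _ = max-perturbed v v in y , y∈

  max-≥ : ∀ {v x y} → x ∈ hull → y ∈ Max v → v ∙ y ≤ v ∙ x → x ∈ Max v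
  max-≥ x∈H (_ , max) le = x∈H , λ z z∈H → ≤-trans (max z z∈H) le

  max-equal : ∀ {v x y} → x ∈ Max v → y ∈ Max v → v ∙ x ≈ v ∙ y
  max-equal {v} {x} {y} (x∈H , x-max) (y∈H , y-max) = antisym (y-max x x∈H) (x-max y y∈H)

  -- As f attains both maxima at once, a maximizer of the sum can fall short in neither summand.
  max-⊕⁻ : ∀ {v w f x} → f ∈ Max v → f ∈ Max w → x ∈ Max (v ⊕ w) → x ∈ Max v × x ∈ Max w
  max-⊕⁻ {v} {w} {f} {x} f∈v@(f∈H , v≤) f∈w@(_ , w≤) (x∈H , vw≤) =
    max-≥ {v} x∈H f∈v (squeezeˡ (v ∙ f) (w ∙ f) (v ∙ x) (w ∙ x) sum≤ (w≤ x x∈H)) ,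
    max-≥ {w} x∈H f∈w (squeezeʳ (v ∙ f) (w ∙ f) (v ∙ x) (w ∙ x) sum≤ (v≤ x x∈H))
    where
    sum≤ : v ∙ f + w ∙ f ≤ v ∙ x + w ∙ x
    sum≤ = ≤-resp₂ (∙-⊕ v w f) (∙-⊕ v w x) (vw≤ f f∈H)

  -- If y maximises both v and v + δu, then Max v ∩ Max (v + δu) consists of
  -- the points that maximise u on Max v.
  refine : ∀ v u → ∃[ g ] (Max g ⊆ Max v × (∀ x y → x ∈ Max g → y ∈ Max g → u ∙ x ≈ u ∙ y))
  refine v u with max-perturbed v u
  ... | δ , y , (_ , 0≉δ) , y∈v , y∈v′ =
    v ⊕ (v ⊕ δ ⊙ u) , (λ {x} x∈ → proj₁ (both {x} x∈)) ,
    λ x x′ x∈ x′∈ → constant (both {x} x∈) (both {x′} x′∈)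
    where
    both : ∀ {x} → x ∈ Max (v ⊕ (v ⊕ δ ⊙ u)) → x ∈ Max v × x ∈ Max (v ⊕ δ ⊙ u)
    both {x} = max-⊕⁻ {v} {v ⊕ δ ⊙ u} {y} {x} y∈v y∈v′

    constant : ∀ {x x′} → x ∈ Max v × x ∈ Max (v ⊕ δ ⊙ u) →
               x′ ∈ Max v × x′ ∈ Max (v ⊕ δ ⊙ u) → u ∙ x ≈ u ∙ x′
    constant {x} {x′} (x∈ , x∈′) (x′∈ , x′∈′) = slope-unique (0≉δ ∘ sym) (max-equal {v} {x} {x′} x∈ x′∈)
      (trans (sym (∙-affine v δ u x)) (trans (max-equal {v ⊕ δ ⊙ u} {x} {x′} x∈′ x′∈′) (∙-affine v δ u x′)))

  refine-all : ∀ k (us : Fin k → Vector Carrier n) v →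
    ∃[ g ] (Max g ⊆ Max v × (∀ j x y → x ∈ Max g → y ∈ Max g → us j ∙ x ≈ us j ∙ y))
  refine-all zero    us v = v , (λ x∈ → x∈) , λ ()
  refine-all (suc k) us v =
    let g  , g⊆v  , const₀ = refine v (us Fin.zero)
        g′ , g′⊆g , const  = refine-all k (us ∘ Fin.suc) g
    in g′ , (λ {x} x∈ → g⊆v {x} (g′⊆g {x} x∈)) , λ
    { Fin.zero x y x∈ y∈ → const₀ x y (g′⊆g {x} x∈) (g′⊆g {y} y∈) ; (Fin.suc j) → const j }

  max-vertex : ∀ v → ∃[ g ] (Max g ⊆ Max v × (∀ x y → x ∈ Max g → y ∈ Max g → ∀ i → x i ≈ y i))
  max-vertex v =
    let g , g⊆v , const = refine-all n δ v
    in g , g⊆v , λ x y x∈ y∈ i → trans (sym (δ-∙ i x)) (trans (const i x y x∈ y∈) (δ-∙ i y))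

  -- A larger normal cone contains g, so its nonempty face lies in `Max g` and hence consists of the
  -- same vertex; its normals are then normals of that vertex.
  vertex-cone-maximal : ∀ {g} → (∀ x y → x ∈ Max g → y ∈ Max g → ∀ i → x i ≈ y i) →
                        IsMaximalCone ℝ P (NormalCone ℝ P (Max g))
  vertex-cone-maximal {g} vertex =
    (Max g , (g , id , id) , id , id) ,
    λ { C′ (F′ , (v′ , F′⊆v′ , v′⊆F′) , C′⊆ , ⊆C′) N⊆C′ {w} w∈C′ {x} x∈g →
        let y , y∈v′ = max-nonempty v′
            y∈g = C′⊆ (N⊆C′ {g} id) (v′⊆F′ y∈v′)
            y∈w = C′⊆ w∈C′ (v′⊆F′ y∈v′)
        in max-≥ (proj₁ x∈g) y∈w (≤-reflexive (∙-cong {v = w} (λ _ → refl) (vertex y x y∈g x∈g))) }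

  face-nonempty : ∀ {F} → IsFace ℝ P F → ∃ F
  face-nonempty (v , _ , v⊆F) = let y , y∈ = max-nonempty v in y , v⊆F y∈

  max-perturbed⇒max : ∀ {v u δ y} → 0# < δ → y ∈ Max v → y ∈ Max (v ⊕ δ ⊙ u) →
                      ∀ {z} → z ∈ Max v → u ∙ z ≤ u ∙ y
  max-perturbed⇒max {v} {u} {δ} {y} 0<δ y∈v (_ , max) {z} z∈v = slope-≤ 0<δ (max-equal {v} z∈v y∈v)
    (≤-resp₂ (∙-affine v δ u z) (∙-affine v δ u y) (max z (proj₁ z∈v)))

  ConstantOn : Pred (Vector Carrier n) 0ℓ → Vector Carrier n → Set
  ConstantOn S w = ∀ {y z} → y ∈ S → z ∈ S → w ∙ y ≈ w ∙ z

  -- Perturbing v by w and by -w produces points where w is largest and smallest on the face;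
  -- comparing these two values decides the question.
  constant? : ∀ v w → ConstantOn (Max v) w ⊎ (∃[ y ] ∃[ z ] (y ∈ Max v × z ∈ Max v × ¬ (w ∙ y ≈ w ∙ z)))
  constant? v w with max-perturbed v w | max-perturbed v (- 1# ⊙ w)
  ... | δ , y , 0<δ , y∈v , y∈δ | ε , z , 0<ε , z∈v , z∈ε with w ∙ y ≟ w ∙ z
  ...   | no  neq = inj₂ (y , z , y∈v , z∈v , neq)
  ...   | yes eq  = inj₁ λ a∈ b∈ → trans (≈y a∈) (sym (≈y b∈))
    where
    negate : ∀ x → (- 1# ⊙ w) ∙ x ≈ - (w ∙ x)
    negate x = trans (∙-⊙ (- 1#) w x) (-1*x≈-x (w ∙ x))

    ≈y : ∀ {a} → a ∈ Max v → w ∙ a ≈ w ∙ y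
    ≈y {a} a∈ = antisym (max-perturbed⇒max 0<δ y∈v y∈δ a∈)
      (≤-trans (≤-reflexive eq) (-‿anti-≤⁻¹ (≤-resp₂ (negate a) (negate z) (max-perturbed⇒max 0<ε z∈v z∈ε a∈))))

  -- The W a are r equations of the face, independent because of their dual vectors U; this bounds
  -- the dimension from above. That every other constant functional depends on them bounds it from
  -- below.
  max-dimension : ∀ {r d} v (U W : Fin r → Vector Carrier n) →
    (∀ a b → W a ∙ U b ≈ δ a b) →
    (∀ a → ConstantOn (Max v) (W a)) →
    (∀ w → ConstantOn (Max v) w → (∀ a → U a ∙ w ≈ 0#) → ∀ i → w i ≈ 0#) →
    d ℕ.+ r ≡ n → HasDimension ℝ (Max v) d
  max-dimension {r} {d} v U W dual const trivial d+r≡n =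
    dimension-≥ (max-nonempty v) U
      (λ w U∙w≈0 (i , wᵢ≉0) → case constant? v w of λ
        { (inj₁ w-const) → contradiction (trivial w w-const U∙w≈0 i) wᵢ≉0
        ; (inj₂ moves)   → moves })
      d (ℕ.≤-reflexive d+r≡n) ,
    λ p p∈ indep → dimension-≤ {S = Max v} U W dual
      (λ a → W a ∙ y , λ x x∈ → const a x∈ y∈)
      (s≤s (s≤s (ℕ.≤-reflexive (≡.sym d+r≡n)))) (p , p∈ , indep)
    where
    y  = proj₁ (max-nonempty v)
    y∈ = proj₂ (max-nonempty v)

  dimension-resp-≐ : ∀ {S T : Pred (Vector Carrier n) 0ℓ} {d} → S ≐ T → HasDimension ℝ S d → HasDimension ℝ T d
  dimension-resp-≐ (S⊆T , T⊆S) ((p , p∈S , indep) , at-most) =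
    (p , S⊆T ∘ p∈S , indep) , λ q q∈T → at-most q (T⊆S ∘ q∈T)

-- Faces maximising an indicator, in a fan of order cones.

module OrderConeFan (ℝ : RealNumbers) {d : ℕ} (P : Polytope ℝ (suc (suc d)))
  (poset : Rectangulation ℝ (suc (suc d)) → Rel (Fin (suc (suc d))) 0ℓ)
  (fan : MaximalConesAre ℝ P (λ R → OrderCone ℝ (poset R)))
  (separating : ∀ X → ∃[ R ] ( (∀ {i j} → poset R i j → lookup X i ≡ true → lookup X j ≡ true)
                             × (∀ {i j} → lookup X i ≡ lookup X j → i ≢ j → poset R i j ⊎ poset R j i)))
  where
  open OrderedField ℝ
  open LinearAlgebra ℝ
  open Lexicographic ℝ
  open PolytopeFaces ℝ P

  private
    n = suc (suc d)

  e : Subset n → Vector Carrier n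
  e = indicator ℝ

  e-in : ∀ X {i} → lookup X i ≡ true → e X i ≈ 1#
  e-in X i∈X = reflexive (≡.cong (λ b → if b then 1# else 0#) i∈X)

  e-out : ∀ X {i} → lookup X i ≡ false → e X i ≈ 0#
  e-out X i∉X = reflexive (≡.cong (λ b → if b then 1# else 0#) i∉X)

  0≤e : ∀ X i → 0# ≤ e X i
  0≤e X i with lookup X i
  ... | true  = 0≤1
  ... | false = ≤-refl

  increasing⇒e-mono : ∀ X i j → (lookup X i ≡ true → lookup X j ≡ true) → e X i ≤ e X j
  increasing⇒e-mono X i j inc with lookup X i
  ... | true  = ≤-reflexive (sym (e-in X (inc ≡.refl)))
  ... | false = 0≤e X j

  -- If w is normal to the face Max (e X), then both w and e X - δ w, for some
  -- δ > 0, lie in the cone of a rectangulation separating X, so that w is both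
  -- increasing and decreasing along its relations within X or its complement.
  class-constant : ∀ X w → NormalCone ℝ P (Max (e X)) w → ∀ {i j} → lookup X i ≡ lookup X j → w i ≈ w j
  class-constant X w w∈N {i} {j} i~j = case i Fin.≟ j of λ
    { (yes i≡j) → reflexive (≡.cong w i≡j)
    ; (no  i≢j) → case connecting i~j i≢j of λ
      { (inj₁ i≺j) → equal i≺j i~j
      ; (inj₂ j≺i) → sym (equal j≺i (≡.sym i~j)) } }
    where
    R          = proj₁ (separating X)
    increasing = proj₁ (proj₂ (separating X))
    connecting = proj₂ (proj₂ (separating X))
    F₀         = proj₁ (proj₁ (proj₁ fan R))
    cone⊆      = proj₁ (proj₂ (proj₂ (proj₁ (proj₁ fan R))))
    ⊆cone      = proj₂ (proj₂ (proj₂ (proj₁ (proj₁ fan R))))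

    F₀⊆ : F₀ ⊆ Max (e X)
    F₀⊆ = cone⊆ {e X} λ i j i≺j → increasing⇒e-mono X i j (increasing i≺j)

    w∈cone : OrderCone ℝ (poset R) w
    w∈cone = ⊆cone {w} λ {x} x∈ → w∈N {x} (F₀⊆ {x} x∈)

    perturbed = max-perturbed (e X) (- 1# ⊙ w)
    δ₀  = proj₁ perturbed
    y   = proj₁ (proj₂ perturbed)
    0<δ : 0# < δ₀
    0<δ = proj₁ (proj₂ (proj₂ perturbed))
    y∈e : y ∈ Max (e X)
    y∈e = proj₁ (proj₂ (proj₂ (proj₂ perturbed)))
    y∈δ : y ∈ Max (e X ⊕ δ₀ ⊙ (- 1# ⊙ w))
    y∈δ = proj₂ (proj₂ (proj₂ (proj₂ perturbed)))

    -- Both e X and w are constant on `Max (e X)`, which contains y and F₀, so the perturbed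
    -- functional attains its maximum on F₀ too.
    same-value : ∀ x → x ∈ F₀ → (e X ⊕ δ₀ ⊙ (- 1# ⊙ w)) ∙ y ≈ (e X ⊕ δ₀ ⊙ (- 1# ⊙ w)) ∙ x
    same-value x x∈ = begin
      (e X ⊕ δ₀ ⊙ (- 1# ⊙ w)) ∙ y         ≈⟨ ∙-affine (e X) δ₀ (- 1# ⊙ w) y ⟩
      e X ∙ y + δ₀ * (- 1# ⊙ w) ∙ y       ≈⟨ +-cong (max-equal {e X} y∈e (F₀⊆ {x} x∈)) (*-congˡ (begin
        (- 1# ⊙ w) ∙ y                      ≈⟨ ∙-⊙ (- 1#) w y ⟩
        - 1# * w ∙ y                        ≈⟨ *-congˡ (max-equal {w} (w∈N {y} y∈e) (w∈N {x} (F₀⊆ {x} x∈))) ⟩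
        - 1# * w ∙ x                        ≈⟨ ∙-⊙ (- 1#) w x ⟨
        (- 1# ⊙ w) ∙ x                      ∎)) ⟩
      e X ∙ x + δ₀ * (- 1# ⊙ w) ∙ x       ≈⟨ ∙-affine (e X) δ₀ (- 1# ⊙ w) x ⟨
      (e X ⊕ δ₀ ⊙ (- 1# ⊙ w)) ∙ x         ∎
      where open ≈-Reasoning

    e-δw∈cone : OrderCone ℝ (poset R) (e X ⊕ δ₀ ⊙ (- 1# ⊙ w))
    e-δw∈cone = ⊆cone {e X ⊕ δ₀ ⊙ (- 1# ⊙ w)} λ {x} x∈ →
      max-≥ {e X ⊕ δ₀ ⊙ (- 1# ⊙ w)} (proj₁ (F₀⊆ {x} x∈)) y∈δ (≤-reflexive (same-value x x∈))

    equal : ∀ {i j} → poset R i j → lookup X i ≡ lookup X j → w i ≈ w j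
    equal {i} {j} i≺j i~j = antisym (w∈cone i j i≺j) (-‿anti-≤⁻¹ (≤-resp₂ (-1*x≈-x (w i)) (-1*x≈-x (w j))
      (slope-≤ 0<δ (reflexive (≡.cong (λ b → if b then 1# else 0#) i~j)) (e-δw∈cone i j i≺j))))

  ones : Vector Carrier n
  ones _ = 1#

  -- Both (1, ..., 1) and its negative satisfy all order relations, so they lie in every cone and a
  -- point of the corresponding face maximises both. Here `⊤` serves to pick a rectangulation.
  ones-constant : ConstantOn hull ones
  ones-constant {y} {z} y∈H z∈H = trans (at-f y∈H) (sym (at-f z∈H))
    where
    R     = proj₁ (separating ⊤)
    face  = proj₁ (proj₁ fan R)
    f     = proj₁ (face-nonempty (proj₁ (proj₂ face)))
    f∈F₀  = proj₂ (face-nonempty (proj₁ (proj₂ face)))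
    cone⊆ = proj₁ (proj₂ (proj₂ face))

    at-f : ∀ {x} → x ∈ hull → ones ∙ x ≈ ones ∙ f
    at-f {x} x∈H = antisym
      (proj₂ (cone⊆ {ones} (λ _ _ _ → ≤-refl) {f} f∈F₀) x x∈H)
      (-‿anti-≤⁻¹ (≤-resp₂ (negate x) (negate f) (proj₂ (cone⊆ { - 1# ⊙ ones} (λ _ _ _ → ≤-refl) {f} f∈F₀) x x∈H)))
      where
      negate : ∀ x → (- 1# ⊙ ones) ∙ x ≈ - (ones ∙ x)
      negate x = trans (∙-⊙ (- 1#) ones x) (-1*x≈-x (ones ∙ x))

  -- A functional constant on the polytope is normal to every face, and for X = `⊤` all labels form
  -- one class.
  constant-on-hull : ∀ w → ConstantOn hull w → ∀ i j → w i ≈ w j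
  constant-on-hull w const i j = class-constant ⊤ w
    (λ {x} x∈ → proj₁ x∈ , λ y y∈H → ≤-reflexive (const {y} {x} y∈H (proj₁ x∈)))
    (≡.trans (Vec.lookup-replicate i true) (≡.sym (Vec.lookup-replicate j true)))

  affine-value : ∀ {a b v w} → (∀ i → w i ≈ a * v i + b) → ∀ x → w ∙ x ≈ a * v ∙ x + b * ones ∙ x
  affine-value {a} {b} {v} {w} w≈ x = begin
    w ∙ x                             ≈⟨ ∙-cong {y = x} (λ i → trans (w≈ i) (+-congˡ (sym (*-identityʳ b))))
                                                        (λ _ → refl) ⟩
    (a ⊙ v ⊕ b ⊙ ones) ∙ x            ≈⟨ ∙-⊕ (a ⊙ v) (b ⊙ ones) x ⟩
    (a ⊙ v) ∙ x + (b ⊙ ones) ∙ x      ≈⟨ +-cong (∙-⊙ a v x) (∙-⊙ b ones x) ⟩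
    a * v ∙ x + b * ones ∙ x          ∎
    where open ≈-Reasoning

  affine-normal : ∀ {a b v w} → 0# ≤ a → (∀ i → w i ≈ a * v i + b) → Max v ⊆ Max w
  affine-normal {a} {b} {v} {w} 0≤a w≈ {x} (x∈H , max) = x∈H , λ y y∈H →
    ≤-resp₂ (sym (affine-value {a} {b} {v} {w} w≈ y)) (sym (affine-value {a} {b} {v} {w} w≈ x))
      (+-mono-≤ (*-monoˡ-≤ 0≤a (max y y∈H)) (≤-reflexive (*-congˡ (ones-constant {y} {x} y∈H x∈H))))

  -- A negative coefficient a would make e X constant on the polytope.
  affine-normal⁻¹ : ∀ X {i₀ j₀} → lookup X i₀ ≡ true → lookup X j₀ ≡ false → ∀ {a b w} →
    NormalCone ℝ P (Max (e X)) w → (∀ i → w i ≈ a * e X i + b) → 0# ≤ a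
  affine-normal⁻¹ X {i₀} {j₀} i₀∈X j₀∉X {a} {b} {w} w∈N w≈ = case 0# ≤? a of λ
    { (yes 0≤a) → 0≤a
    ; (no  0≰a) → contradiction
        (trans (sym (e-out X j₀∉X)) (trans (constant-on-hull (e X) (constant (≰⇒> 0≰a)) j₀ i₀) (e-in X i₀∈X)))
        0≉1 }
    where
    f  = proj₁ (max-nonempty (e X))
    f∈ = proj₂ (max-nonempty (e X))

    0<-a : a < 0# → 0# < - a
    0<-a (a≤0 , a≉0) = ≤-resp₂ (solve 0 (:- con (+ 0) := con (+ 0)) refl) refl (-‿anti-≤ a≤0)
      , λ 0≈-a → a≉0 (trans (solve 1 (λ a → a := :- (:- a)) refl a)
                          (trans (-‿cong (sym 0≈-a)) (solve 0 (:- con (+ 0) := con (+ 0)) refl)))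

    f≤ : a < 0# → ∀ {y} → y ∈ hull → e X ∙ f ≤ e X ∙ y
    f≤ a<0 {y} y∈H = *-cancelˡ-≤ (0<-a a<0) (≤-resp₂ (neg-* (e X ∙ f)) (neg-* (e X ∙ y)) (-‿anti-≤
      (squeezeˡ (a * e X ∙ y) (b * ones ∙ y) (a * e X ∙ f) (b * ones ∙ f)
        (≤-resp₂ (affine-value {a} {b} {e X} {w} w≈ y) (affine-value {a} {b} {e X} {w} w≈ f)
          (proj₂ (w∈N {f} f∈) y y∈H))
        (≤-reflexive (*-congˡ (ones-constant {f} {y} (proj₁ f∈) y∈H))))))
      where
      neg-* : ∀ s → - (a * s) ≈ - a * s
      neg-* s = solve 2 (λ a s → :- (a :* s) := (:- a) :* s) refl a s

    constant : a < 0# → ConstantOn hull (e X)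
    constant a<0 {y} {z} y∈H z∈H = trans (at-f {y} y∈H) (sym (at-f {z} z∈H))
      where
      at-f : ∀ {y} → y ∈ hull → e X ∙ y ≈ e X ∙ f
      at-f {y} y∈H = antisym (proj₂ f∈ y y∈H) (f≤ a<0 {y} y∈H)

  module ProperSubset (X : Subset n) {i₀ j₀} (i₀∈X : lookup X i₀ ≡ true) (j₀∉X : lookup X j₀ ≡ false) where

    class-≈ : ∀ {w : Vector Carrier n} → (∀ {i j} → lookup X i ≡ lookup X j → w i ≈ w j) →
              ∀ i → w i ≈ (w i₀ - w j₀) * e X i + w j₀
    class-≈ {w} class i with lookup X i in eq
    ... | true  = trans (class (≡.trans eq (≡.sym i₀∈X)))
                    (solve 2 (λ a b → a := (a :- b) :* con (+ 1) :+ b) refl (w i₀) (w j₀))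
    ... | false = trans (class (≡.trans eq (≡.sym j₀∉X)))
                    (solve 2 (λ a b → b := (a :- b) :* con (+ 0) :+ b) refl (w i₀) (w j₀))

    outer-normal : HasOuterNormal ℝ P (Max (e X)) (e X)
    outer-normal =
      (λ {w} w∈N → let w≈ = class-≈ {w} (class-constant X w w∈N) in
         w i₀ - w j₀ , w j₀ , affine-normal⁻¹ X i₀∈X j₀∉X {w = w} w∈N w≈ , w≈) ,
      (λ {w} (a , b , 0≤a , w≈) {x} → affine-normal {a} {b} {e X} {w} 0≤a w≈ {x})

    -- Although w itself need not be normal to the face, e X + δ w is for some δ > 0, and within a
    -- class the term e X cancels.
    class-constant-on-face : ∀ w → ConstantOn (Max (e X)) w → ∀ {i j} → lookup X i ≡ lookup X j → w i ≈ w j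
    class-constant-on-face w const {i} {j} i~j = slope-unique (proj₂ 0<δ ∘ sym)
      (reflexive (≡.cong (λ b → if b then 1# else 0#) i~j))
      (class-constant X (e X ⊕ δ₀ ⊙ w) normal i~j)
      where
      perturbed = max-perturbed (e X) w
      δ₀  = proj₁ perturbed
      y   = proj₁ (proj₂ perturbed)
      0<δ : 0# < δ₀
      0<δ = proj₁ (proj₂ (proj₂ perturbed))
      y∈e : y ∈ Max (e X)
      y∈e = proj₁ (proj₂ (proj₂ (proj₂ perturbed)))
      y∈δ : y ∈ Max (e X ⊕ δ₀ ⊙ w)
      y∈δ = proj₂ (proj₂ (proj₂ (proj₂ perturbed)))

      normal : NormalCone ℝ P (Max (e X)) (e X ⊕ δ₀ ⊙ w)
      normal {x} x∈ = max-≥ {e X ⊕ δ₀ ⊙ w} (proj₁ x∈) y∈δ (≤-reflexive (begin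
        (e X ⊕ δ₀ ⊙ w) ∙ y       ≈⟨ ∙-affine (e X) δ₀ w y ⟩
        e X ∙ y + δ₀ * w ∙ y     ≈⟨ +-cong (max-equal {e X} y∈e x∈) (*-congˡ (const {y} {x} y∈e x∈)) ⟩
        e X ∙ x + δ₀ * w ∙ x     ≈⟨ ∙-affine (e X) δ₀ w x ⟨
        (e X ⊕ δ₀ ⊙ w) ∙ x       ∎))
        where open ≈-Reasoning

    face-dimension : HasDimension ℝ (Max (e X)) d
    face-dimension = max-dimension (e X) U W dual constant trivial (ℕ.+-comm d 2)
      where
      -- The two equations of the face are given by the indicators of X and of its complement; unit
      -- vectors of one label from each class are dual to them.
      U W : Fin 2 → Vector Carrier n
      U 0F = δ i₀
      U 1F = δ j₀
      W 0F = e X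
      W 1F = ones ⊕ - 1# ⊙ e X

      at : ∀ w k → w ∙ δ k ≈ w k
      at w k = trans (∙-comm w (δ k)) (δ-∙ k w)

      dual : ∀ a b → W a ∙ U b ≈ δ a b
      dual 0F 0F = trans (at (e X) i₀) (e-in X i₀∈X)
      dual 0F 1F = trans (at (e X) j₀) (e-out X j₀∉X)
      dual 1F 0F = trans (at (W 1F) i₀) (trans (+-congˡ (*-congˡ (e-in X i₀∈X)))
        (solve 0 (con (+ 1) :+ (:- con (+ 1)) :* con (+ 1) := con (+ 0)) refl))
      dual 1F 1F = trans (at (W 1F) j₀) (trans (+-congˡ (*-congˡ (e-out X j₀∉X)))
        (solve 0 (con (+ 1) :+ (:- con (+ 1)) :* con (+ 0) := con (+ 1)) refl))

      constant : ∀ a → ConstantOn (Max (e X)) (W a)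
      constant 0F {y} {z} y∈ z∈ = max-equal {e X} y∈ z∈
      constant 1F {y} {z} y∈ z∈ = begin
        W 1F ∙ y                     ≈⟨ ∙-affine ones (- 1#) (e X) y ⟩
        ones ∙ y + - 1# * e X ∙ y    ≈⟨ +-cong (ones-constant {y} {z} (proj₁ y∈) (proj₁ z∈))
                                               (*-congˡ (max-equal {e X} y∈ z∈)) ⟩
        ones ∙ z + - 1# * e X ∙ z    ≈⟨ ∙-affine ones (- 1#) (e X) z ⟨
        W 1F ∙ z                     ∎
        where open ≈-Reasoning

      trivial : ∀ w → ConstantOn (Max (e X)) w → (∀ a → U a ∙ w ≈ 0#) → ∀ i → w i ≈ 0#
      trivial w const U∙w≈0 i with lookup X i in eq
      ... | true  = trans (class-constant-on-face w const (≡.trans eq (≡.sym i₀∈X)))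
                      (trans (sym (δ-∙ i₀ w)) (U∙w≈0 0F))
      ... | false = trans (class-constant-on-face w const (≡.trans eq (≡.sym j₀∉X)))
                      (trans (sym (δ-∙ j₀ w)) (U∙w≈0 1F))

  -- The whole polytope is the face of the zero functional, and its only equation is the one for the
  -- coordinate sum.
  hull-dimension : HasDimension ℝ hull (suc d)
  hull-dimension = dimension-resp-≐ {S = Max zeros} (proj₁ , all∈)
    (max-dimension zeros U W dual constant trivial (ℕ.+-comm (suc d) 1))
    where
    zeros : Vector Carrier n
    zeros _ = 0#

    vanish : ∀ x → zeros ∙ x ≈ 0#
    vanish = 0∙ (λ _ → refl)

    all∈ : ∀ {x} → x ∈ hull → x ∈ Max zeros
    all∈ {x} x∈H = x∈H , λ y _ → ≤-reflexive (trans (vanish y) (sym (vanish x)))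

    U W : Fin 1 → Vector Carrier n
    U _ = δ 0F
    W _ = ones

    dual : ∀ a b → W a ∙ U b ≈ δ a b
    dual 0F 0F = trans (∙-comm ones (δ 0F)) (δ-∙ 0F ones)

    constant : ∀ a → ConstantOn (Max zeros) (W a)
    constant _ {y} {z} y∈ z∈ = ones-constant {y} {z} (proj₁ y∈) (proj₁ z∈)

    trivial : ∀ w → ConstantOn (Max zeros) w → (∀ a → U a ∙ w ≈ 0#) → ∀ i → w i ≈ 0#
    trivial w const U∙w≈0 i = trans (constant-on-hull w everywhere i 0F) (trans (sym (δ-∙ 0F w)) (U∙w≈0 0F))
      where
      everywhere : ConstantOn hull w
      everywhere {y} {z} y∈ z∈ = const {y} {z} (all∈ {y} y∈) (all∈ {z} z∈)

-- Facets and nonempty proper subsets.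

module FacetBijection (ℝ : RealNumbers) {d : ℕ} (P : Polytope ℝ (suc (suc d)))
  (poset : Rectangulation ℝ (suc (suc d)) → Rel (Fin (suc (suc d))) 0ℓ)
  (fan : MaximalConesAre ℝ P (λ R → OrderCone ℝ (poset R)))
  (separating : ∀ X → ∃[ R ] ( (∀ {i j} → poset R i j → lookup X i ≡ true → lookup X j ≡ true)
                             × (∀ {i j} → lookup X i ≡ lookup X j → i ≢ j → poset R i j ⊎ poset R j i)))
  where
  open OrderedField ℝ
  open LinearAlgebra ℝ
  open Lexicographic ℝ
  open PolytopeFaces ℝ P
  open Vector using (_∷_)
  open OrderConeFan ℝ P poset fan separating

  private
    n = suc (suc d)

  max-indicator-facet : ∀ X {i₀ j₀} → lookup X i₀ ≡ true → lookup X j₀ ≡ false → IsFacet ℝ P (Max (e X))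
  max-indicator-facet X i₀∈X j₀∉X =
    (e X , (λ x∈ → x∈) , (λ x∈ → x∈)) , d , hull-dimension , ProperSubset.face-dimension X i₀∈X j₀∉X

  -- The facet with normal v lies in the facet with normal e X, where X is the
  -- complement of the set of minimal coordinates of v: for small ε > 0, both
  -- e X and v - ε e X increase wherever v does.
  module FacetNormal (v : Vector Carrier n) (nonconstant : ∃[ i ] ¬ (v i ≈ v 0F)) where

    least : ∃[ k ] (∀ j → v k ≤ v j)
    least = finite-min v

    k = proj₁ least

    differs : Fin n → Bool
    differs i = not (does (v i ≟ v k))

    X : Subset n
    X = tabulate differs

    X-true : ∀ {i} → ¬ (v i ≈ v k) → lookup X i ≡ true
    X-true {i} neq = ≡.trans (Vec.lookup∘tabulate differs i) (≡.cong not (dec-false (v i ≟ v k) neq))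

    X-false : ∀ {i} → v i ≈ v k → lookup X i ≡ false
    X-false {i} eq = ≡.trans (Vec.lookup∘tabulate differs i) (≡.cong not (dec-true (v i ≟ v k) eq))

    k∉X : lookup X k ≡ false
    k∉X = X-false refl

    X-nonempty : ∃[ i ] lookup X i ≡ true
    X-nonempty = case v 0F ≟ v k of λ
      { (no  neq) → 0F , X-true neq
      ; (yes eq)  → proj₁ nonconstant , X-true λ eq′ → proj₂ nonconstant (trans eq′ (sym eq)) }

    -- Lowering v by at most the least positive excess over its minimum, on all of X, cannot push a
    -- coordinate below that minimum.
    gap : ∃[ ε ] (0# < ε × (∀ i → ¬ (v i - v k ≈ 0#) → ε ≤ v i - v k))
    gap = finite-gap (λ i → v i - v k) (λ i → ≤⇒0≤- (proj₂ least i))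

    ε = proj₁ gap
    0<ε : 0# < ε
    0<ε = proj₁ (proj₂ gap)

    v′ : Vector Carrier n
    v′ = v ⊕ - ε ⊙ e X

    X-increasing : ∀ i j → v i ≤ v j → lookup X i ≡ true → lookup X j ≡ true
    X-increasing i j vi≤vj i∈X = case v j ≟ v k of λ
      { (no  neq) → X-true neq
      ; (yes eq)  → case ≡.trans (≡.sym i∈X) 
                    (X-false (antisym (≤-trans vi≤vj (≤-reflexive eq)) (proj₂ least i))) of λ () }

    v′-mono : ∀ i j → v i ≤ v j → v′ i ≤ v′ j
    v′-mono i j vi≤vj = case (v i ≟ v k) of λ
      { (no  i≉k) → same true (X-true {i} i≉k) (X-increasing i j vi≤vj (X-true {i} i≉k))
      ; (yes i≈k) → case (v j ≟ v k) of λ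
        { (yes j≈k) → same false (X-false {i} i≈k) (X-false {j} j≈k)
        ; (no  j≉k) → ≤-resp₂ (+-congˡ (*-congˡ (sym (e-out X {i} (X-false {i} i≈k)))))
                              (+-congˡ (*-congˡ (sym (e-in X {j} (X-true {j} j≉k))))) (jump i≈k j≉k) } }
      where
      jump : v i ≈ v k → ¬ (v j ≈ v k) → v i + - ε * 0# ≤ v j + - ε * 1#
      jump i≈k j≉k = ≤-resp₂
        (trans (solve 2 (λ a c → c :+ (a :- c) := a :+ (:- c) :* con (+ 0)) refl (v k) ε) (+-congʳ (sym i≈k)))
        (solve 3 (λ a b c → (b :- a) :+ (a :- c) := b :+ (:- c) :* con (+ 1)) refl (v k) (v j) ε)
        (+-mono-≤ (proj₂ (proj₂ gap) j (j≉k ∘ x-y≈0⇒x≈y)) ≤-refl)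

      same : ∀ b → lookup X i ≡ b → lookup X j ≡ b → v′ i ≤ v′ j
      same b i≡b j≡b = +-mono-≤ vi≤vj (≤-reflexive (*-congˡ (reflexive
        (≡.cong (λ b → if b then 1# else 0#) (≡.trans i≡b (≡.sym j≡b))))))

    -- Completeness of the fan: the normal cone of a vertex of the face `Max v` is maximal, so it is
    -- the cone of some rectangulation, and it contains v.
    vertex = max-vertex v
    g = proj₁ vertex

    g⊆v : Max g ⊆ Max v
    g⊆v = proj₁ (proj₂ vertex)

    R = proj₁ (proj₂ fan (NormalCone ℝ P (Max g)) (vertex-cone-maximal {g} (proj₂ (proj₂ vertex))))

    normal≐cone : NormalCone ℝ P (Max g) ≐ OrderCone ℝ (poset R)
    normal≐cone = proj₂ (proj₂ fan (NormalCone ℝ P (Max g)) (vertex-cone-maximal {g} (proj₂ (proj₂ vertex))))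

    v∈cone : OrderCone ℝ (poset R) v
    v∈cone = proj₁ normal≐cone {v} g⊆v

    g⊆e : Max g ⊆ Max (e X)
    g⊆e = proj₂ normal≐cone {e X} λ i j i≺j → increasing⇒e-mono X i j (X-increasing i j (v∈cone i j i≺j))

    g⊆v′ : Max g ⊆ Max v′
    g⊆v′ = proj₂ normal≐cone {v′} λ i j i≺j → v′-mono i j (v∈cone i j i≺j)

    f = proj₁ (max-nonempty g)

    f∈g : f ∈ Max g
    f∈g = proj₂ (max-nonempty g)

    -- Since v = v′ + ε e X and f maximises both summands, no maximizer of v can be worse than f for
    -- e X.
    v⊆e : Max v ⊆ Max (e X)
    v⊆e {x} x∈v = max-≥ {e X} (proj₁ x∈v) (g⊆e {f} f∈g) (*-cancelˡ-≤ 0<ε (-‿anti-≤⁻¹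
      (≤-resp₂ (neg-* (e X ∙ x)) (neg-* (e X ∙ f))
      (squeezeʳ (v ∙ x) (- ε * e X ∙ x) (v ∙ f) (- ε * e X ∙ f)
        (≤-resp₂ (∙-affine v (- ε) (e X) x) (∙-affine v (- ε) (e X) f)
          (proj₂ (g⊆v′ {f} f∈g) x (proj₁ x∈v)))
        (proj₂ x∈v f (proj₁ f∈g))))))
      where
      neg-* : ∀ s → - ε * s ≈ - (ε * s)
      neg-* s = solve 2 (λ a s → (:- a) :* s := :- (a :* s)) refl ε s

  -- A constant normal is maximal on the whole polytope, whose dimension is one too large for F.
  normal-nonconstant : ∀ {v F d′} → F ≐ Max v → HasDimension ℝ hull (suc d′) → HasDimension ℝ F d′ →
                       ∃[ i ] ¬ (v i ≈ v 0F)
  normal-nonconstant {v} {F} {d′} (F⊆v , v⊆F) dim-H dim-F = case Fin.any? (λ i → ¬? (v i ≟ v 0F)) of λ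
    { (yes nonconst) → nonconst
    ; (no  const)    → contradiction
        (dimension-unique {S = hull} dim-H (dimension-resp-≐ {S = F} (F⊆H , H⊆F const) dim-F)) ℕ.1+n≢n }
    where
    F⊆H : F ⊆ hull
    F⊆H {x} x∈F = proj₁ (F⊆v {x} x∈F)

    H⊆F : ¬ (∃[ i ] ¬ (v i ≈ v 0F)) → hull ⊆ F
    H⊆F const {x} x∈H = v⊆F {x} (affine-normal {0#} {v 0F} {ones} {v} ≤-refl v≈ {x}
      (x∈H , λ y y∈H → ≤-reflexive (ones-constant {y} {x} y∈H x∈H)))
      where
      v≈ : ∀ i → v i ≈ 0# * 1# + v 0F
      v≈ i = trans (case v i ≟ v 0F of λ { (yes eq) → eq ; (no neq) → contradiction (i , neq) const })
                   (solve 1 (λ a → a := con (+ 0) :* con (+ 1) :+ a) refl (v 0F))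

  facet-normal : ∀ F → IsFacet ℝ P F →
    ∃[ X ] ((∃[ i ] lookup X i ≡ true) × (∃[ j ] lookup X j ≡ false) × Max (e X) ≐ F)
  facet-normal F ((v , F⊆v , v⊆F) , d′ , dim-H , dim-F@((q , q∈F , indep) , _)) =
    X , X-nonempty , (k , k∉X) , e⊆F , λ {x} x∈F → v⊆e {x} (F⊆v {x} x∈F)
    where
    open FacetNormal v (normal-nonconstant {v} {F} (F⊆v , v⊆F) dim-H dim-F)

    q₀ = q 0F

    e⊆F : Max (e X) ⊆ F
    e⊆F {y} y∈e = case v ∙ y ≟ v ∙ q₀ of λ
      { (yes eq)  → v⊆F {y} (max-≥ {v} (proj₁ y∈e) (F⊆v {q₀} (q∈F 0F)) (≤-reflexive (sym eq)))
      -- If v took another value at y, then y and the d + 1 independent points of F would be d + 2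
      -- independent points of a face of dimension d.
      ; (no  neq) → contradiction
          (extend-independent {p = q} {y} v (v ∙ q₀) indep
            (λ j → max-equal {v} (F⊆v {q j} (q∈F j)) (F⊆v {q₀} (q∈F 0F))) neq)
          (proj₂ (≡.subst (HasDimension ℝ (Max (e X))) (≡.sym d′≡d)
                   (ProperSubset.face-dimension X {proj₁ X-nonempty} {k} (proj₂ X-nonempty) k∉X))
            (y ∷ q) λ { 0F → y∈e ; (Fin.suc j) → v⊆e {q j} (F⊆v {q j} (q∈F j)) }) }
      where
      d′≡d : d′ ≡ d
      d′≡d = ℕ.suc-injective (dimension-unique {S = hull} dim-H hull-dimension)

  -- As e Y is normal to the face of X, it equals a e X + b with a nonnegative. So a label in Y and
  -- one outside Y must be separated by X in the same sense.
  max-indicator-injective : ∀ X Y {i₀ j₀ y₀ z₀} →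
    lookup X i₀ ≡ true → lookup X j₀ ≡ false → lookup Y y₀ ≡ true → lookup Y z₀ ≡ false →
    Max (e X) ≐ Max (e Y) → X ≡ Y
  max-indicator-injective X Y {y₀ = y₀} {z₀} i₀∈X j₀∉X y₀∈Y z₀∉Y (X⊆Y , _) =
    ≡.trans (≡.sym (Vec.tabulate∘lookup X)) (≡.trans (Vec.tabulate-cong same) (Vec.tabulate∘lookup Y))
    where
    coefficients = proj₁ (ProperSubset.outer-normal X i₀∈X j₀∉X) {e Y} X⊆Y
    a = proj₁ coefficients
    b = proj₁ (proj₂ coefficients)
    0≤a : 0# ≤ a
    0≤a = proj₁ (proj₂ (proj₂ coefficients))
    eY≈ : ∀ i → e Y i ≈ a * e X i + b
    eY≈ = proj₂ (proj₂ (proj₂ coefficients))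

    monotone : ∀ {i j} → lookup Y i ≡ true → lookup Y j ≡ false →
               lookup X i ≡ true × lookup X j ≡ false
    monotone {i} {j} i∈Y j∉Y with lookup X i in i≡ | lookup X j in j≡
    ... | true  | false = ≡.refl , ≡.refl
    ... | true  | true  = contradiction eYj≈eYi 0≉1
      where
      eYj≈eYi : 0# ≈ 1#
      eYj≈eYi = begin
        0#               ≈⟨ e-out Y j∉Y ⟨
        e Y j            ≈⟨ eY≈ j ⟩
        a * e X j + b    ≈⟨ +-congʳ (*-congˡ (trans (e-in X j≡) (sym (e-in X i≡)))) ⟩
        a * e X i + b    ≈⟨ eY≈ i ⟨
        e Y i            ≈⟨ e-in Y i∈Y ⟩
        1#               ∎
        where open ≈-Reasoning
    ... | false | _     = contradiction 1≤0 (<⇒≱ 0<1)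
      where
      1≤0 : 1# ≤ 0#
      1≤0 = ≤-resp₂
        (trans (+-congʳ (*-congˡ (sym (e-out X i≡)))) (trans (sym (eY≈ i)) (e-in Y i∈Y)))
        (trans (sym (eY≈ j)) (e-out Y j∉Y))
        (+-mono-≤ (*-monoˡ-≤ 0≤a (0≤e X j)) ≤-refl)

    same : ∀ i → lookup X i ≡ lookup Y i
    same i with lookup Y i in i≡
    ... | true  = proj₁ (monotone i≡ z₀∉Y)
    ... | false = proj₂ (monotone y₀∈Y i≡)

  proper-lookup : ∀ {X : Subset n} → Nonempty X × X ⊂ ⊤ → (∃[ i ] lookup X i ≡ true) × (∃[ j ] lookup X j ≡ false)
  proper-lookup {X} ((i , i∈X) , (_ , j , _ , j∉X)) = (i , Vec.[]=⇒lookup i∈X) , j , j-false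
    where
    j-false : lookup X j ≡ false
    j-false with lookup X j in eq
    ... | true  = contradiction (Vec.lookup⇒[]= j X eq) j∉X
    ... | false = ≡.refl

  lookup-proper : ∀ {X : Subset n} → (∃[ i ] lookup X i ≡ true) → (∃[ j ] lookup X j ≡ false) → Nonempty X × X ⊂ ⊤
  lookup-proper {X} (i , i∈X) (j , j∉X) =
    (i , Vec.lookup⇒[]= i X i∈X) , (λ _ → Subset.∈⊤) , j , Subset.∈⊤ ,
    λ j∈X → case ≡.trans (≡.sym j∉X) (Vec.[]=⇒lookup j∈X) of λ ()

  private
    Subsets = nonemptyProperSubsets ℝ n

  facet : Setoid.Carrier Subsets → ∃ (IsFacet ℝ P)
  facet (X , proper) = Max (e X) , max-indicator-facet X (proj₂ (proj₁ members)) (proj₂ (proj₂ members))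
    where members = proper-lookup {X} proper

  facet-cong : ∀ {S T} → proj₁ S ≡ proj₁ T → proj₁ (facet S) ≐ proj₁ (facet T)
  facet-cong {X , _} {.X , _} ≡.refl = (λ x∈ → x∈) , (λ x∈ → x∈)

  facetBijection : Bijection Subsets (facets ℝ P)
  facetBijection = record
    { to        = facet
    ; cong      = λ {S} {T} → facet-cong {S} {T}
    ; bijective =
        (λ {S} {T} eq → let S-members = proper-lookup {proj₁ S} (proj₂ S)
                            T-members = proper-lookup {proj₁ T} (proj₂ T) in
          max-indicator-injective (proj₁ S) (proj₁ T) (proj₂ (proj₁ S-members)) (proj₂ (proj₂ S-members))
                                  (proj₂ (proj₁ T-members)) (proj₂ (proj₂ T-members)) eq) ,
        λ (F , F-facet) → let X , X-nonempty , X-proper , e≐F = facet-normal F F-facet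
                              S = X , lookup-proper {X} X-nonempty X-proper in
          S , λ {T} T≡S → let T⊆S , S⊆T = facet-cong {T} {S} T≡S in
            (λ {x} x∈ → proj₁ e≐F {x} (T⊆S {x} x∈)) , (λ {x} x∈ → S⊆T {x} (proj₂ e≐F {x} x∈))
    }

  facetsIndexedBySubsets : FacetsIndexedBySubsets ℝ P
  facetsIndexedBySubsets = facetBijection , λ (X , proper) →
    let (_ , i₀∈X) , (_ , j₀∉X) = proper-lookup {X} proper in ProperSubset.outer-normal X i₀∈X j₀∉X

-- Counting nonempty proper subsets.

∷-↔ : ∀ n → (Bool × Subset n) ↔ Subset (suc n)
∷-↔ n = mk↔ₛ′ (λ (b , p) → b Vec.∷ p) Vec.uncons (λ { (b Vec.∷ p) → ≡.refl }) (λ { (b , p) → ≡.refl })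

subsets↔ : ∀ n → Fin (2 ^ n) ↔ Subset n
subsets↔ zero    = mk↔ₛ′ (λ _ → Vec.[]) (λ _ → Fin.zero) (λ { Vec.[] → ≡.refl })
                         (λ { Fin.zero → ≡.refl ; (Fin.suc ()) })
subsets↔ (suc n) = ↔-trans (Fin.*↔× {2} {2 ^ n}) (↔-trans (Fin.2↔Bool ×-↔ subsets↔ n) (∷-↔ n))

nonempty : ∀ {n} {X : Subset n} → X ≢ Subset.⊥ → Nonempty X
nonempty {X = X} X≢⊥ = case Subset.nonempty? X of λ
  { (yes ne) → ne ; (no empty) → contradiction (Subset.Empty-unique empty) X≢⊥ }

proper : ∀ {n} {X : Subset n} → X ≢ ⊤ → X ⊂ ⊤
proper {n} {X} X≢⊤ with Fin.¬∀⟶∃¬ n (Subset._∈ X) (Subset._∈? X)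
  (λ all → X≢⊤ (Subset.⊆-antisym (λ _ → Subset.∈⊤) (λ {i} _ → all i)))
... | i , i∉X = (λ _ → Subset.∈⊤) , i , Subset.∈⊤ , i∉X

-- Two uses of `punchIn` skip the indices of the empty and the full set, the second index being
-- renumbered after removal of the first. N is a variable with an equation because a power of 2 does
-- not reduce to the form `suc (suc K)`.
subsetCount : ∀ (ℝ : RealNumbers) {n} N K → N ≡ suc (suc K) → Fin N ↔ Subset (suc n) →
              Bijection (Fin.≡-setoid K) (nonemptyProperSubsets ℝ (suc n))
subsetCount ℝ {n} _ K ≡.refl φ = record
  { to        = to
  ; cong      = λ { ≡.refl → ≡.refl }
  ; bijective = (λ eq → Fin.punchIn-injective _ _ _ (Fin.punchIn-injective _ _ _ (to-injective eq)))
              , λ (X , X-nonempty , X-proper) → onto X X-nonempty X-proper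
  }
  where
  module φ = Inverse φ

  to-injective : ∀ {i j} → φ.to i ≡ φ.to j → i ≡ j
  to-injective {i} {j} eq = ≡.trans (≡.sym (φ.strictlyInverseʳ i)) (≡.trans (≡.cong φ.from eq) (φ.strictlyInverseʳ j))

  from-injective : ∀ {X Y} → φ.from X ≡ φ.from Y → X ≡ Y
  from-injective {X} {Y} eq = ≡.trans (≡.sym (φ.strictlyInverseˡ X)) (≡.trans (≡.cong φ.to eq) (φ.strictlyInverseˡ Y))

  ⊥≢⊤ : Subset.⊥ {suc n} ≢ ⊤
  ⊥≢⊤ ()

  a b : Fin (suc (suc K))
  a = φ.from Subset.⊥
  b = φ.from ⊤

  a≢b : a ≢ b
  a≢b = ⊥≢⊤ ∘ from-injective

  b′ : Fin (suc K)
  b′ = punchOut a≢b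

  index : Fin K → Fin (suc (suc K))
  index k = punchIn a (punchIn b′ k)

  index≢a : ∀ k → index k ≢ a
  index≢a k = Fin.punchInᵢ≢i a (punchIn b′ k)

  index≢b : ∀ k → index k ≢ b
  index≢b k eq = Fin.punchInᵢ≢i b′ k (Fin.punchIn-injective a _ _
    (≡.trans eq (≡.sym (Fin.punchIn-punchOut a≢b))))

  avoids : ∀ k Y → index k ≢ φ.from Y → φ.to (index k) ≢ Y
  avoids k Y neq eq = neq (≡.trans (≡.sym (φ.strictlyInverseʳ (index k))) (≡.cong φ.from eq))

  to : Fin K → Σ[ X ∈ Subset (suc n) ] (Nonempty X × X ⊂ ⊤)
  to k = φ.to (index k) , nonempty (avoids k Subset.⊥ (index≢a k)) , proper (avoids k ⊤ (index≢b k))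

  onto : ∀ X → Nonempty X → X ⊂ ⊤ → ∃[ k ] (∀ {j} → j ≡ k → proj₁ (to j) ≡ X)
  onto X (i , i∈X) (_ , j , _ , j∉X) = k , λ { ≡.refl → ≡.trans (≡.cong φ.to index-k) (φ.strictlyInverseˡ X) }
    where
    x = φ.from X

    a≢x : a ≢ x
    a≢x eq = Subset.∉⊥ (≡.subst (i Subset.∈_) (≡.sym (from-injective eq)) i∈X)

    b≢x : b ≢ x
    b≢x eq = j∉X (≡.subst (j Subset.∈_) (from-injective eq) Subset.∈⊤)

    b′≢x′ : b′ ≢ punchOut a≢x
    b′≢x′ = b≢x ∘ Fin.punchOut-injective a≢b a≢x

    k = punchOut b′≢x′

    index-k : index k ≡ x
    index-k = ≡.trans (≡.cong (punchIn a) (Fin.punchIn-punchOut b′≢x′)) (Fin.punchIn-punchOut a≢x)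

-- The facet theorem for the weak and the strong rectangulotope.

module _ (ℝ : RealNumbers) {d : ℕ} (P : Polytope ℝ (suc (suc d)))
  (poset : Rectangulation ℝ (suc (suc d)) → Rel (Fin (suc (suc d))) 0ℓ)
  (increasing : ∀ X → CornerPosets.Increasing ℝ X (poset (CornerRectangulation.rectangulation ℝ X)))
  (connecting : ∀ X → CornerPosets.Connecting ℝ X (poset (CornerRectangulation.rectangulation ℝ X)))
  where

  facetTheorem : MaximalConesAre ℝ P (λ R → OrderCone ℝ (poset R)) →
                 HasFacetCount ℝ P (2 ^ suc (suc d) ∸ 2) × FacetsIndexedBySubsets ℝ P
  facetTheorem fan =
    Composition.bijection (subsetCount ℝ (2 ^ suc (suc d)) _ 2^n≡ (subsets↔ (suc (suc d)))) facetBijection ,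
    facetsIndexedBySubsets
    where
    open FacetBijection ℝ P poset fan (λ X → CornerRectangulation.rectangulation ℝ X , increasing X , connecting X)

    2^n≡ : 2 ^ suc (suc d) ≡ 2 ℕ.+ (2 ^ suc (suc d) ∸ 2)
    2^n≡ = ≡.sym (ℕ.m+[n∸m]≡n (ℕ.^-monoʳ-≤ 2 {1} {suc (suc d)} (s≤s z≤n)))

mainTheorem3 : (ℝ : RealNumbers) (n : ℕ) → 2 ℕ.≤ n →
    ((P : Polytope ℝ n) → IsWeakRectangulotope ℝ P →
    HasFacetCount ℝ P (2 ^ n ∸ 2) × FacetsIndexedBySubsets ℝ P) ×
    ((P : Polytope ℝ n) → IsStrongRectangulotope ℝ P →
    HasFacetCount ℝ P (2 ^ n ∸ 2) × FacetsIndexedBySubsets ℝ P)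
mainTheorem3 ℝ (suc (suc d)) (s≤s (s≤s z≤n)) =
  (λ P → facetTheorem ℝ P (WeakPoset ℝ ∘ Rectangulation.decomposition)
    (λ X → CornerPosets.weakPoset-increasing ℝ X) (λ X → CornerPosets.weakPoset-connecting ℝ X)) ,
  (λ P → facetTheorem ℝ P (StrongPoset ℝ ∘ Rectangulation.decomposition)
    (λ X → CornerPosets.strongPoset-increasing ℝ X) (λ X → CornerPosets.strongPoset-connecting ℝ X))
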